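{- Let $R$ be a finite simple connected graph having no leaves and no two distinct vertices with the same closed neighborhood, and let $n\geq 1$. Then the sibling number and the tuft number have joint symmetric distribution on the set of unlabeled connected graphs with $n$ vertices whose reduction is isomorphic to $R$; that is, $\sum_G x^{s(G)}y^{t(G)}$, summed over the isomorphism classes of connected graphs $G$ with $n$ vertices whose reduction is isomorphic to $R$, is symmetric in $x$ and $y$.
   Context: All graphs are finite and simple. The closed neighborhood of a vertex $v$ is $N[v]=\{v\}\cup\{u: u\text{ adjacent to }v\}$. Two distinct vertices are siblings if they have the same closed neighborhood. A leaf is a vertex of degree one. The tuft number $t(G)$ is the maximal number of leaves adjacent to a single vertex ($0$ if there are none); the sibling number is $s(G)=\max_{v}\lvert\{u: N[u]=N[v]\}\rvert-1$. For a connected graph $G$ other than the complete graph $K_2$, its reduction is the graph obtained by repeatedly (i) removing all leaves and (ii) contracting each maximal group of siblings to a single vertex (adjacent to the common neighbors of the group outside it), until a graph with neither leaves nor siblings is reached. -}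

module Defs where

open import Data.Bool.Base using (Bool; false; T; not; _∧_; _∨_)
open import Data.Bool.Properties as Bool using (∨-comm; ∨-idem; T?)
open import Data.Fin.Base as Fin using (Fin; funToFin; finToFun)
open import Data.Fin.Permutation using (Permutation; permutation; _⟨$⟩ʳ_; _⟨$⟩ˡ_; inverseˡ; inverseʳ)
import Data.Fin.Permutation as Perm
import Data.Fin.Properties as Finₚ
open import Data.Fin.Properties using (2↔Bool; all?; any?; ¬∀⟶∃¬; finToFun-funToFin)
open import Data.Fin.Subset using (Subset; ⁅_⁆; _∪_; ∣_∣)
open import Data.List.Base as List using (List; []; _∷_; length; filter; allFin; lookup; deduplicate; foldr)
open import Data.List.Extrema.Nat using (max)
open import Data.List.Membership.Propositional using (_∈_; lose)
open import Data.List.Membership.Propositional.Properties using (∈-allFin)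
open import Data.List.Properties using (length-filter; filter-notAll; length-tabulate)
open import Data.List.Relation.Unary.Any using (Any; here; there)
open import Data.List.Relation.Unary.Any.Properties using (map⁺)
open import Data.Nat.Base using (ℕ; _+_; _∸_; _^_; _≤_; _<_)
open import Data.Nat.Induction using (<-wellFounded)
import Data.Nat.Properties as ℕₚ
open import Data.Product.Base using (∃; _×_; _,_; proj₁; proj₂)
open import Data.Sum.Base using (_⊎_; inj₁; inj₂; [_,_]′)
import Data.Vec.Base as Vec
import Data.Vec.Properties as Vecₚ
open import Function.Base using (_∘_; id)
open import Function.Bundles using (module Inverse)
open import Induction.WellFounded using (Acc; acc)
open import Relation.Binary.Construct.Closure.ReflexiveTransitive using (Star; ε; _◅_; _◅◅_)
open import Relation.Binary.PropositionalEquality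
  using (_≡_; _≢_; refl; sym; trans; cong; cong₂)
open import Relation.Nullary.Decidable
  using (Dec; yes; no; does; ¬?; _×-dec_; _⊎-dec_; _→-dec_; map′; dec-true)
open import Relation.Nullary.Negation using (¬_; contradiction)
open import Relation.Unary using (Pred; Decidable)
open import Level using (0ℓ)

record Graph (n : ℕ) : Set where
  field
    adj        : Fin n → Fin n → Bool
    adj-sym    : ∀ u v → adj u v ≡ adj v u
    adj-irrefl : ∀ v → adj v v ≡ false

open Graph public

Adjacent : ∀ {n} → Graph n → Fin n → Fin n → Set
Adjacent G u v = T (adj G u v)

infix 4 _≅_ _≅?_

record _≅_ {n m : ℕ} (G : Graph n) (H : Graph m) : Set where
  field
    bijection : Permutation n m
    preserves : ∀ u v → adj H (bijection ⟨$⟩ʳ u) (bijection ⟨$⟩ʳ v) ≡ adj G u v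

complete : ∀ n → Graph n
complete n = record
  { adj        = λ u v → not (does (u Finₚ.≟ v))
  ; adj-sym    = λ u v → cong not (≟-swap u v)
  ; adj-irrefl = λ v → cong not (dec-true (v Finₚ.≟ v) refl)
  }
  where
  ≟-swap : ∀ (u v : Fin n) → does (u Finₚ.≟ v) ≡ does (v Finₚ.≟ u)
  ≟-swap u v with u Finₚ.≟ v | v Finₚ.≟ u
  ... | yes _ | yes _ = refl
  ... | no  _ | no  _ = refl
  ... | yes p | no ¬q = contradiction (sym p) ¬q
  ... | no ¬p | yes q = contradiction (sym q) ¬p

-- The graph without vertices is not considered connected.
Connected : ∀ {n} → Graph n → Set
Connected {n} G = (1 ≤ n) × (∀ u v → Star (Adjacent G) u v)

module _ {n : ℕ} (G : Graph n) where

  neighbours : Fin n → Subset n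
  neighbours v = Vec.tabulate (adj G v)

  N[_] : Fin n → Subset n
  N[ v ] = ⁅ v ⁆ ∪ neighbours v

  degree : Fin n → ℕ
  degree v = ∣ neighbours v ∣

  Leaf : Fin n → Set
  Leaf v = degree v ≡ 1

  Siblings : Fin n → Fin n → Set
  Siblings u v = u ≢ v × N[ u ] ≡ N[ v ]

  NoLeaves : Set
  NoLeaves = ∀ v → ¬ Leaf v

  NoSiblings : Set
  NoSiblings = ∀ u v → ¬ Siblings u v

  Leaf? : Decidable Leaf
  Leaf? v = degree v ℕₚ.≟ 1

  sameN? : ∀ u v → Dec (N[ u ] ≡ N[ v ])
  sameN? u v = Vecₚ.≡-dec Bool._≟_ N[ u ] N[ v ]

  NoLeaves? : Dec NoLeaves
  NoLeaves? = all? (¬? ∘ Leaf?)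

  NoSiblings? : Dec NoSiblings
  NoSiblings? = all? λ u → all? λ v → ¬? (¬? (u Finₚ.≟ v) ×-dec sameN? u v)

select : ∀ {n} {P : Pred (Fin n) 0ℓ} → Decidable P → List (Fin n)
select {n} P? = filter P? (allFin n)

count : ∀ {n} {P : Pred (Fin n) 0ℓ} → Decidable P → ℕ
count P? = length (select P?)

maximum : ∀ {n} → (Fin n → ℕ) → ℕ
maximum f = max 0 (List.tabulate f)

tuftNumber : ∀ {n} → Graph n → ℕ
tuftNumber G = maximum λ v → count λ u → T? (adj G v u) ×-dec Leaf? G u

siblingNumber : ∀ {n} → Graph n → ℕ
siblingNumber G = maximum (λ v → count λ u → sameN? G u v) ∸ 1

-- The subgraph induced by the vertices satisfying P, renumbered in order.
induced : ∀ {n} (G : Graph n) {P : Pred (Fin n) 0ℓ} (P? : Decidable P) → Graph (count P?)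
induced G P? = record
  { adj        = λ i j → adj G (lookup (select P?) i) (lookup (select P?) j)
  ; adj-sym    = λ i j → adj-sym G (lookup (select P?) i) (lookup (select P?) j)
  ; adj-irrefl = λ i → adj-irrefl G (lookup (select P?) i)
  }

module _ {n : ℕ} (G : Graph n) where

  notLeaf? : Decidable (λ v → ¬ Leaf G v)
  notLeaf? v = ¬? (Leaf? G v)

  deleteLeaves : Graph (count notLeaf?)
  deleteLeaves = induced G notLeaf?

  -- Siblings have the same neighbours outside their group, so identifying
  -- each group to a point amounts to keeping one member of it: the least.
  Representative : Fin n → Set
  Representative v = ∀ u → N[_] G u ≡ N[_] G v → v Fin.≤ u

  Representative? : Decidable Representative
  Representative? v = all? λ u → sameN? G u v →-dec v Finₚ.≤? u

  contractSiblings : Graph (count Representative?)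
  contractSiblings = induced G Representative?

-- G ↠ H: the reduction process, started at G, stops at H.  It alternates
-- the removal of all leaves with the contraction of all sibling groups;
-- when there are no leaves, the removal is void and is skipped.  After a
-- contraction there are no siblings, so leaves are never removed from an
-- intermediate graph isomorphic to K₂.
infix 4 _↠_

data _↠_ {n : ℕ} (G : Graph n) : {m : ℕ} → Graph m → Set where
  stop  : NoLeaves G → NoSiblings G → G ↠ G
  prune : ∀ {m} {H : Graph m} → ¬ NoLeaves G →
          contractSiblings (deleteLeaves G) ↠ H → G ↠ H
  merge : ∀ {m} {H : Graph m} → NoLeaves G → ¬ NoSiblings G →
          contractSiblings G ↠ H → G ↠ H

record ConnectedWithReduction {m n : ℕ} (R : Graph m) (G : Graph n) : Set where
  constructor conn
  field
    connected : Connected G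
    notK₂     : ¬ (G ≅ complete 2)
    reduction : ∃ λ k → ∃ λ (H : Graph k) → G ↠ H × H ≅ R

-- finToFun and funToFin with the dimensions explicit: they cannot be inferred
-- from Fin (q ^ p).
fun : ∀ p q → Fin (q ^ p) → Fin p → Fin q
fun p q = finToFun {q} {p}

code : ∀ p q → (Fin p → Fin q) → Fin (q ^ p)
code p q = funToFin {p} {q}

fun-code : ∀ p q f i → fun p q (code p q f) i ≡ f i
fun-code p q = finToFun-funToFin

_≅?_ : ∀ {n m} (G : Graph n) (H : Graph m) → Dec (G ≅ H)
_≅?_ {n} {m} G H = map′ to from
  (any? λ a → pres? a ×-dec any? λ b → inverses? a b)
  where
  Pres : Fin (m ^ n) → Set
  Pres a = ∀ u v → adj H (fun n m a u) (fun n m a v) ≡ adj G u v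
  pres? : Decidable Pres
  pres? a = all? λ u → all? λ v → _ Bool.≟ _
  Inverses : Fin (m ^ n) → Fin (n ^ m) → Set
  Inverses a b = (∀ y → fun n m a (fun m n b y) ≡ y) × (∀ x → fun m n b (fun n m a x) ≡ x)
  inverses? : ∀ a b → Dec (Inverses a b)
  inverses? a b = all? (λ y → _ Finₚ.≟ y) ×-dec all? (λ x → _ Finₚ.≟ x)
  to : (∃ λ a → Pres a × ∃ λ b → Inverses a b) → G ≅ H
  to (a , p , b , ab , ba) = record
    { bijection = permutation (fun n m a) (fun m n b) ab ba ; preserves = p }
  from : G ≅ H → ∃ λ a → Pres a × ∃ λ b → Inverses a b
  from i = code n m f
         , (λ u v → trans (cong₂ (adj H) (f≗ u) (f≗ v)) (_≅_.preserves i u v))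
         , code m n g
         , (λ y → trans (f≗ _) (trans (cong f (g≗ y)) (inverseʳ π)))
         , (λ x → trans (g≗ _) (trans (cong g (f≗ x)) (inverseˡ π)))
    where
    π = _≅_.bijection i
    f = π ⟨$⟩ʳ_
    g = π ⟨$⟩ˡ_
    f≗ = fun-code n m f
    g≗ = fun-code m n g

module _ {n : ℕ} (G : Graph n) where

  -- Walks whose inner vertices lie in the list.
  Via : List (Fin n) → Fin n → Fin n → Set
  Via []       u v = u ≡ v ⊎ Adjacent G u v
  Via (x ∷ xs) u v = Via xs u v ⊎ (Via xs u x × Via xs x v)

  Via? : ∀ xs u v → Dec (Via xs u v)
  Via? []       u v = (u Finₚ.≟ v) ⊎-dec T? (adj G u v)
  Via? (x ∷ xs) u v = Via? xs u v ⊎-dec (Via? xs u x ×-dec Via? xs x v)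

  Via⇒Star : ∀ xs {u v} → Via xs u v → Star (Adjacent G) u v
  Via⇒Star []       (inj₁ refl)    = ε
  Via⇒Star []       (inj₂ e)       = e ◅ ε
  Via⇒Star (x ∷ xs) (inj₁ p)       = Via⇒Star xs p
  Via⇒Star (x ∷ xs) (inj₂ (p , q)) = Via⇒Star xs p ◅◅ Via⇒Star xs q

  Via-base : ∀ xs {u v} → Via [] u v → Via xs u v
  Via-base []       p = p
  Via-base (x ∷ xs) p = inj₁ (Via-base xs p)

  Via-trans : ∀ {xs u w v} → w ∈ xs → Via xs u w → Via xs w v → Via xs u v
  Via-trans (here refl) p q = inj₂ ([ id , proj₁ ]′ p , [ id , proj₂ ]′ q)
  Via-trans (there w∈) (inj₁ p)       (inj₁ q)       = inj₁ (Via-trans w∈ p q)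
  Via-trans (there w∈) (inj₁ p)       (inj₂ (q , r)) = inj₂ (Via-trans w∈ p q , r)
  Via-trans (there w∈) (inj₂ (p , q)) (inj₁ r)       = inj₂ (p , Via-trans w∈ q r)
  Via-trans (there w∈) (inj₂ (p , _)) (inj₂ (_ , s)) = inj₂ (p , s)

  Star⇒Via : ∀ {u v} → Star (Adjacent G) u v → Via (allFin n) u v
  Star⇒Via ε       = Via-base (allFin n) (inj₁ refl)
  Star⇒Via (e ◅ p) = Via-trans (∈-allFin _) (Via-base (allFin n) (inj₂ e)) (Star⇒Via p)

  Connected? : Dec (Connected G)
  Connected? = (1 ℕₚ.≤? n) ×-dec
    all? λ u → all? λ v → map′ (Via⇒Star (allFin n)) Star⇒Via (Via? (allFin n) u v)

module _ {n : ℕ} {P : Pred (Fin n) 0ℓ} (P? : Decidable P) where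

  count-≤ : count P? ≤ n
  count-≤ = ℕₚ.≤-trans (length-filter P? (allFin n)) (ℕₚ.≤-reflexive (length-tabulate id))

  count-< : (∃ λ v → ¬ P v) → count P? < n
  count-< (v , ¬p) = ℕₚ.<-≤-trans (filter-notAll P? (allFin n) (lose (∈-allFin v) ¬p))
                                  (ℕₚ.≤-reflexive (length-tabulate id))

module _ {n : ℕ} (G : Graph n) where

  prune-< : ¬ NoLeaves G → count (Representative? (deleteLeaves G)) < n
  prune-< ¬nl with ¬∀⟶∃¬ n _ (notLeaf? G) ¬nl
  ... | v , ¬¬leaf = ℕₚ.≤-<-trans (count-≤ (Representative? (deleteLeaves G)))
                                  (count-< (notLeaf? G) (v , ¬¬leaf))

  merge-< : ¬ NoSiblings G → count (Representative? G) < n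
  merge-< ¬ns = count-< (Representative? G)
    (¬∀⟶∃¬ n (Representative G) (Representative? G) λ rep →
      ¬ns λ u v (u≢v , eq) → u≢v (Finₚ.≤-antisym (rep u v (sym eq)) (rep v u eq)))

normalise : ∀ {n} (G : Graph n) → Acc _<_ n → ∃ λ k → ∃ λ (H : Graph k) → G ↠ H
normalise G (acc rs) with NoLeaves? G | NoSiblings? G
... | no ¬nl | _      = let k , H , r = normalise _ (rs (prune-< G ¬nl)) in k , H , prune ¬nl r
... | yes nl | yes ns = _ , G , stop nl ns
... | yes nl | no ¬ns = let k , H , r = normalise _ (rs (merge-< G ¬ns)) in k , H , merge nl ¬ns r

↠-deterministic : ∀ {n k l} {G : Graph n} {H : Graph k} {H′ : Graph l} →
                  G ↠ H → G ↠ H′ → (P : ∀ {m} → Graph m → Set) → P H → P H′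
↠-deterministic (stop _ _)     (stop _ _)      P p = p
↠-deterministic (stop nl _)    (prune ¬nl _)   P p = contradiction nl ¬nl
↠-deterministic (stop _ ns)    (merge _ ¬ns _) P p = contradiction ns ¬ns
↠-deterministic (prune ¬nl _)  (stop nl _)     P p = contradiction nl ¬nl
↠-deterministic (prune _ r)    (prune _ r′)    P p = ↠-deterministic r r′ P p
↠-deterministic (prune ¬nl _)  (merge nl _ _)  P p = contradiction nl ¬nl
↠-deterministic (merge _ ¬ns _) (stop _ ns)    P p = contradiction ns ¬ns
↠-deterministic (merge nl _ _) (prune ¬nl _)   P p = contradiction nl ¬nl
↠-deterministic (merge _ _ r)  (merge _ _ r′)  P p = ↠-deterministic r r′ P p

ConnectedWithReduction? : ∀ {m n} (R : Graph m) → Decidable (ConnectedWithReduction {m} {n} R)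
ConnectedWithReduction? {n = n} R G = map′
  (λ (c , k , r) → conn c k r) (λ (conn c k r) → c , k , r)
  (Connected? G ×-dec ¬? (G ≅? complete 2) ×-dec reduction?)
  where
  reduction? : Dec (∃ λ k → ∃ λ (H : Graph k) → G ↠ H × H ≅ R)
  reduction? with normalise G (<-wellFounded n)
  ... | k , H , r = map′ (λ i → k , H , r , i)
                         (λ (_ , _ , r′ , i) → ↠-deterministic r′ r (_≅ R) i)
                         (H ≅? R)

symmetrise : ∀ {n} → (Fin n → Fin n → Bool) → Graph n
symmetrise f = record
  { adj        = λ u v → adj (complete _) u v ∧ (f u v ∨ f v u)
  ; adj-sym    = λ u v → cong₂ _∧_ (adj-sym (complete _) u v) (∨-comm (f u v) (f v u))
  ; adj-irrefl = λ v → cong (_∧ (f v v ∨ f v v)) (adj-irrefl (complete _) v)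
  }

-- Numbers below (2 ^ n) ^ n encode the n × n Boolean matrices.
decode : ∀ {n} → Fin ((2 ^ n) ^ n) → Graph n
decode {n} k = symmetrise λ u v → Inverse.to 2↔Bool (fun n 2 (fun n (2 ^ n) k u) v)

allGraphs : ∀ n → List (Graph n)
allGraphs n = List.map decode (allFin ((2 ^ n) ^ n))

allGraphs-complete : ∀ {n} (G : Graph n) → Any (G ≅_) (allGraphs n)
allGraphs-complete {n} G = map⁺ (lose (∈-allFin matrix) record
  { bijection = Perm.id ; preserves = same })
  where
  bits : Fin n → Fin n → Fin 2
  bits u v = Inverse.from 2↔Bool (adj G u v)
  row : Fin n → Fin (2 ^ n)
  row u = code n 2 (bits u)
  matrix : Fin ((2 ^ n) ^ n)
  matrix = code n (2 ^ n) row
  entry : ∀ u v → Inverse.to 2↔Bool (fun n 2 (fun n (2 ^ n) matrix u) v) ≡ adj G u v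
  entry u v = trans (cong (λ r → Inverse.to 2↔Bool (fun n 2 r v)) (fun-code n (2 ^ n) row u))
             (trans (cong (Inverse.to 2↔Bool) (fun-code n 2 (bits u) v))
                    (Inverse.strictlyInverseˡ 2↔Bool (adj G u v)))
  same : ∀ u v → adj (decode matrix) u v ≡ adj G u v
  same u v = trans
    (cong (adj (complete n) u v ∧_)
      (trans (cong₂ _∨_ (entry u v) (trans (entry v u) (adj-sym G v u))) (∨-idem (adj G u v))))
    loopless
    where
    loopless : adj (complete n) u v ∧ adj G u v ≡ adj G u v
    loopless with u Finₚ.≟ v
    ... | yes refl = sym (adj-irrefl G u)
    ... | no  _    = refl

-- One graph from each isomorphism class of connected graphs with n vertices
-- whose reduction is isomorphic to R.
isoClasses : ∀ {m} → Graph m → ∀ n → List (Graph n)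
isoClasses R n = deduplicate _≅?_ (filter (ConnectedWithReduction? R) (allGraphs n))

-- P i j is the coefficient of xⁱ yʲ.
Poly : Set
Poly = ℕ → ℕ → ℕ

0ₚ : Poly
0ₚ i j = 0

infixl 6 _+ₚ_
_+ₚ_ : Poly → Poly → Poly
(P +ₚ Q) i j = P i j + Q i j

infix 8 x^_y^_
x^_y^_ : ℕ → ℕ → Poly
(x^ a y^ b) i j with i ℕₚ.≟ a ×-dec j ℕₚ.≟ b
... | yes _ = 1
... | no  _ = 0

∑ : ∀ {A : Set} → List A → (A → Poly) → Poly
∑ xs f = foldr (λ a P → f a +ₚ P) 0ₚ xs

infix 5 ∑
syntax ∑ xs (λ a → P) = ∑[ a ∈ xs ] P

Symmetric : Poly → Set
Symmetric P = ∀ i j → P i j ≡ P j i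

-- Fix a, b ≥ 2 and give the vertices colours.  Merge a siblings of the same
-- colour c into one vertex, or merge a vertex and b − 1 of its leaves, all of
-- the same colour c, into one vertex; record the merge by a letter added to c.
-- On connected graphs with at least three vertices both merging and its inverse
-- have the diamond property, so merging is a bijection from the graphs that
-- cannot be expanded to the graphs that cannot be merged, where the colours
-- have been extended by words.  The former do not depend on which of the two
-- kinds of merge has size a and which has size b, hence neither does the number
-- of the latter of a given total weight.  By induction on the number of vertices
-- (for all sets of colours at once) the graphs on which some word is non-empty
-- can be cancelled.  With a single colour this says that the graphs with s ≤ i
-- and t ≤ j are as many as those with s ≤ j and t ≤ i, and differences give the
-- coefficients.  Merging does not change the reduction, because removing a leaf
-- or one of two siblings is confluent as well.

module Submission where

open import Defs

open import Data.Bool.Base using (Bool; true; false; not; _∧_; _∨_; if_then_else_)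
import Data.Bool.Properties as Boolₚ
open import Data.Bool.Properties using (T?)
open import Data.Empty using (⊥-elim-irr)
open import Data.Fin.Base as Fin using (Fin; zero; suc; splitAt; _↑ˡ_; _↑ʳ_)
open import Data.Fin.Permutation as Perm using (Permutation; ↔⇒≡; _⟨$⟩ʳ_; _⟨$⟩ˡ_)
import Data.Fin.Properties as Finₚ
open import Data.Fin.Subset using (⁅_⁆; ∣_∣)
open import Data.List.Base as List using (List; []; _∷_; lookup; allFin; length; filter)
open import Data.List.Extrema.Nat using (max≤v⁺; xs≤max)
open import Data.List.Membership.Propositional using (_∈_; lose; find)
open import Data.List.Membership.Propositional.Properties
  using (∈-filter⁺; ∈-filter⁻; ∈-lookup; ∈-allFin; ∈-upTo⁺; ∈-map⁺; ∈-++⁺ˡ; ∈-++⁺ʳ; ∈-cartesianProduct⁺)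
import Data.List.Properties as Listₚ
open import Data.List.Relation.Unary.All as All using (All)
import Data.List.Relation.Unary.All.Properties as Allₚ
open import Data.List.Relation.Unary.AllPairs using (AllPairs; []; _∷_)
import Data.List.Relation.Unary.AllPairs.Properties as AllPairsₚ
open import Data.List.Relation.Unary.Any as Any using (Any; here; there; index)
import Data.List.Relation.Unary.Any.Properties as Anyₚ
open import Data.List.Relation.Unary.Any.Properties using (lookup-index)
open import Data.List.Relation.Unary.Unique.Propositional using (Unique)
open import Data.List.Relation.Unary.Unique.Propositional.Properties using (filter⁺; allFin⁺)
open import Data.Maybe.Base using (Maybe; just; nothing)
open import Data.Nat.Base using (ℕ; zero; suc; _+_; _*_; _^_; _∸_; _≤_; _<_; z≤n; s≤s; s≤s⁻¹)
open import Data.Nat.Induction using (<-wellFounded)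
import Data.Nat.Properties as ℕₚ
open import Data.Nat.Solver using (module +-*-Solver)
open import Data.Product.Base using (∃; _×_; _,_; proj₁; proj₂)
open import Data.Sum.Base as Sum using (_⊎_; inj₁; inj₂; [_,_]; [_,_]′)
open import Data.Sum.Function.Propositional using (_⊎-↔_)
open import Data.Unit.Base using (⊤; tt)
import Data.Vec.Base as Vec
import Data.Vec.Properties as Vecₚ
open import Function.Base using (_∘_; id; flip)
open import Function.Bundles using (_↔_; mk↔ₛ′; module Inverse; mk⇔; module Equivalence)
import Function.Construct.Composition as Compose
import Function.Construct.Symmetry as Symmetry
open import Induction.WellFounded using (Acc; acc)
open import Level using (Level; 0ℓ)
open import Relation.Binary.Construct.Closure.ReflexiveTransitive using (Star; ε; _◅_; _◅◅_; gmap; reverse)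
open import Relation.Binary.Core using (Rel)
open import Relation.Binary.PropositionalEquality
  using (_≡_; _≢_; refl; sym; trans; cong; cong₂; subst; module ≡-Reasoning)
open import Relation.Binary.Structures using (IsEquivalence)
open import Relation.Nullary.Decidable
  using (Dec; yes; no; does; map′; ¬?; _×-dec_; _⊎-dec_; dec-true; dec-false; does-⇔; recompute; decidable-stable; ¬¬-excluded-middle)
open import Relation.Nullary.Negation using (¬_; contradiction)
open import Relation.Unary using (Decidable)

open import Algebra.Properties.CommutativeMonoid.Sum ℕₚ.+-0-commutativeMonoid using (sum; sum-permute; sum-cong-≗)

-- `d` holds the bounds i and j under test, and a forbidden group has one vertex more than a
-- permitted one: at most `d` extra siblings or leaves means no group of `d + 2` vertices, so a and
-- b are i + 2 and j + 2. `τ` assigns the bounds to the kinds. Groups are monochromatic because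
-- otherwise the colours lost in a merge could not be recovered from the new one. A letter records
-- the size of the group and not its kind, which makes the inexpandable graphs the same for both
-- assignments. Cancellation rests on a count of vertices. If the vertices stand for `k + 1`
-- vertices in all and some word is non-empty, then at most `k` vertices are left, and the induction
-- hypothesis applies over the larger set of colours; the other graphs have `k + 1` vertices and
-- carry old colours only. Every such round fixes one more total, hence families of weights instead
-- of a single one. Colours range over arbitrary types without decidable equality, so classes are
-- counted classically under double negation, which equations between numbers discharge.

private variable
  ℓ₁ ℓ₂ : Level

-- Counting up to equivalence, and rewriting

infixl 1 _>>=_
_>>=_ : {A : Set ℓ₁} {B : Set ℓ₂} → ¬ ¬ A → (A → ¬ ¬ B) → ¬ ¬ B
(m >>= k) ¬b = m λ x → k x ¬b

return : {A : Set ℓ₁} → A → ¬ ¬ A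
return x ¬x = ¬x x

¬¬-∀ : ∀ {n} {P : Fin n → Set ℓ₁} → (∀ i → ¬ ¬ P i) → ¬ ¬ (∀ i → P i)
¬¬-∀ {n = zero}  p = return λ ()
¬¬-∀ {n = suc n} p = p zero >>= λ p₀ → ¬¬-∀ (p ∘ suc) >>= λ ps →
  return λ { zero → p₀ ; (suc i) → ps i }

-- The exit from classical reasoning: excluded middle may be used freely as long as the final claim
-- compares numbers.
≡-stable : ∀ {m n : ℕ} → ¬ ¬ (m ≡ n) → m ≡ n
≡-stable {m} {n} = decidable-stable (m ℕₚ.≟ n)

-- The number of ≈-classes satisfying P, in the sense of classical logic: no
-- decidability of P or ≈ is assumed, and the covering is doubly negated.
record Size {X : Set ℓ₁} (_≈_ : Rel X 0ℓ) (P : X → Set ℓ₂) (n : ℕ) : Set (ℓ₁ Level.⊔ ℓ₂) where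
  field
    rep       : Fin n → X
    satisfies : ∀ i → P (rep i)
    distinct  : ∀ {i j} → rep i ≈ rep j → i ≡ j
    covers    : ∀ x → P x → ¬ ¬ ∃ λ i → x ≈ rep i

module _ {X Y : Set ℓ₁} {_≈₁_ : Rel X 0ℓ} {_≈₂_ : Rel Y 0ℓ} {P : X → Set ℓ₂} {Q : Y → Set ℓ₂}
         (≈₁-equiv : IsEquivalence _≈₁_) (≈₂-equiv : IsEquivalence _≈₂_) where

  private
    module E₁ = IsEquivalence ≈₁-equiv
    module E₂ = IsEquivalence ≈₂-equiv

  -- A relation takes the place of a function because `total` and `covers` hold only up to double
  -- negation. Finitely many doubly negated choices can be made at once, which gives an injection
  -- from `Fin m` to `Fin n`.
  size-≤ : ∀ {r} (_∼_ : X → Y → Set r) →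
           (∀ x → P x → ¬ ¬ ∃ λ y → Q y × (x ∼ y)) →
           (∀ {x x′ y y′} → P x → P x′ → x ∼ y → x′ ∼ y′ → y ≈₂ y′ → x ≈₁ x′) →
           ∀ {m n} → Size _≈₁_ P m → Size _≈₂_ Q n → m ≤ n
  size-≤ _∼_ total injective {m} {n} S T =
    decidable-stable (m ℕₚ.≤? n) (¬¬-∀ image >>= λ f → return (Finₚ.injective⇒≤ {f = proj₁ ∘ f} (f-inj f)))
    where
    module S = Size S
    module T = Size T
    Image : Fin m → Set _
    Image i = ∃ λ j → ∃ λ y → (S.rep i ∼ y) × (y ≈₂ T.rep j)
    image : ∀ i → ¬ ¬ Image i
    image i = total (S.rep i) (S.satisfies i) >>= λ (y , q , r) →
      T.covers y q >>= λ (j , e) → return (j , y , r , e)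
    f-inj : (f : ∀ i → Image i) → ∀ {i i′} → proj₁ (f i) ≡ proj₁ (f i′) → i ≡ i′
    f-inj f {i} {i′} eq with f i | f i′
    ... | j , y , r , e | j′ , y′ , r′ , e′ = S.distinct (injective (S.satisfies i) (S.satisfies i′) r r′
      (E₂.trans e (E₂.trans (E₂.reflexive (cong T.rep eq)) (E₂.sym e′))))

module _ {X : Set ℓ₁} {_≈_ : Rel X 0ℓ} (≈-equiv : IsEquivalence _≈_) where

  private module E = IsEquivalence ≈-equiv

  Invariant : (X → Set ℓ₂) → Set _
  Invariant P = ∀ {x y} → x ≈ y → P x → P y

  size-unique : {P Q : X → Set ℓ₂} → (∀ {x} → P x → Q x) → (∀ {x} → Q x → P x) →
                ∀ {m n} → Size _≈_ P m → Size _≈_ Q n → m ≡ n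
  size-unique to from S T = ℕₚ.≤-antisym
    (size-≤ ≈-equiv ≈-equiv _≈_ (λ x p → return (x , to p , E.refl)) (λ _ _ → square) S T)
    (size-≤ ≈-equiv ≈-equiv _≈_ (λ x p → return (x , from p , E.refl)) (λ _ _ → square) T S)
    where
    square : ∀ {x x′ y y′} → x ≈ y → x′ ≈ y′ → y ≈ y′ → x ≈ x′
    square r r′ e = E.trans r (E.trans e (E.sym r′))

  size-map : {P Q : X → Set ℓ₂} → (∀ {x} → P x → Q x) → (∀ {x} → Q x → P x) →
             ∀ {n} → Size _≈_ P n → Size _≈_ Q n
  size-map to from S = record { Size S ; satisfies = to ∘ Size.satisfies S ; covers = λ x q → Size.covers S x (from q) }

  size-split : ∀ {c} {P : X → Set ℓ₂} {Q : X → Set c} → Invariant Q → ∀ {m n} →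
               Size _≈_ (λ x → P x × Q x) m → Size _≈_ (λ x → P x × ¬ Q x) n → Size _≈_ P (m + n)
  size-split {P = P} {Q = Q} inv {m} {n} S T = record
    { rep       = [ S.rep , T.rep ] ∘ splitAt m
    ; satisfies = satisfies ∘ splitAt m
    ; distinct  = λ {i} {j} e → trans (sym (Finₚ.join-splitAt m n i))
                    (trans (cong [ _↑ˡ n , m ↑ʳ_ ] (distinct (splitAt m i) (splitAt m j) e))
                           (Finₚ.join-splitAt m n j))
    ; covers    = λ x p → ¬¬-excluded-middle >>= λ where
        (yes q) → S.covers x (p , q) >>= λ (i , e) → return
          (i ↑ˡ n , E.trans e (E.reflexive (cong [ S.rep , T.rep ] (sym (Finₚ.splitAt-↑ˡ m i n)))))
        (no ¬q) → T.covers x (p , ¬q) >>= λ (i , e) → return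
          (m ↑ʳ i , E.trans e (E.reflexive (cong [ S.rep , T.rep ] (sym (Finₚ.splitAt-↑ʳ m n i)))))
    }
    where
    module S = Size S
    module T = Size T
    satisfies : ∀ s → P ([ S.rep , T.rep ] s)
    satisfies (inj₁ i) = proj₁ (S.satisfies i)
    satisfies (inj₂ i) = proj₁ (T.satisfies i)
    distinct : ∀ s t → [ S.rep , T.rep ] s ≈ [ S.rep , T.rep ] t → s ≡ t
    distinct (inj₁ i) (inj₁ j) e = cong inj₁ (S.distinct e)
    distinct (inj₂ i) (inj₂ j) e = cong inj₂ (T.distinct e)
    distinct (inj₁ i) (inj₂ j) e =
      contradiction (inv e (proj₂ (S.satisfies i))) (proj₂ (T.satisfies j))
    distinct (inj₂ i) (inj₁ j) e =
      contradiction (inv (E.sym e) (proj₂ (S.satisfies j))) (proj₂ (T.satisfies i))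

  -- A representative is kept when `P` holds for it and it is equivalent to none kept before.
  -- Excluded middle makes both decisions, so the size exists up to double negation.
  size-exists : {P : X → Set ℓ₂} → Invariant P → ∀ {n} (r : Fin n → X) →
                (∀ x → P x → ∃ λ i → x ≈ r i) → ¬ ¬ ∃ (Size _≈_ P)
  size-exists {P = P} inv {n} r total = partial r >>= λ (m , rep , sat , dis , cov) → return (m , record
    { rep = rep ; satisfies = sat ; distinct = dis _ _
    ; covers = λ x p → let i , e = total x p in return
        (let j , e′ = cov i (inv e p) in j , E.trans e e′) })
    where
    Partial : ∀ {n} → (Fin n → X) → Set _
    Partial r = ∃ λ m → ∃ λ (rep : Fin m → X) → (∀ i → P (rep i)) ×
      (∀ i j → rep i ≈ rep j → i ≡ j) × (∀ i → P (r i) → ∃ λ j → r i ≈ rep j)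
    partial : ∀ {n} (r : Fin n → X) → ¬ ¬ Partial r
    partial {zero} r = return (0 , (λ ()) , (λ ()) , (λ ()) , λ ())
    partial {suc n} r = partial (r ∘ suc) >>= λ (m , rep , sat , dis , cov) →
      ¬¬-excluded-middle >>= λ where
        (no ¬p) → return (m , rep , sat , dis ,
          λ { zero p → contradiction p ¬p ; (suc i) → cov i })
        (yes p) → ¬¬-excluded-middle {A = ∃ λ j → r zero ≈ rep j} >>= λ where
          (yes old) → return (m , rep , sat , dis , λ { zero _ → old ; (suc i) → cov i })
          (no new) → return (suc m , (λ { zero → r zero ; (suc j) → rep j })
            , (λ { zero → p ; (suc j) → sat j })
            , (λ { zero zero _ → refl
                 ; zero (suc j) e → contradiction (j , e) new
                 ; (suc j) zero e → contradiction (j , E.sym e) new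
                 ; (suc j) (suc k) e → cong suc (dis j k e) })
            , λ { zero _ → zero , E.refl ; (suc i) p → let j , e = cov i p in suc j , e })

module Rewriting {X : Set ℓ₁} {_≈_ : Rel X 0ℓ} (≈-equiv : IsEquivalence _≈_)
  (P : X → Set ℓ₂) {ℓ : Level} (_▷_ : Rel X ℓ)
  (resp    : ∀ {x x′ y} → x ≈ x′ → x ▷ y → x′ ▷ y)
  (closed  : ∀ {x y} → P x → x ▷ y → P y)
  (diamond : ∀ {x y z} → P x → x ▷ y → x ▷ z → y ≈ z ⊎ ∃ λ w → (y ▷ w) × (z ▷ w))
  where

  private module E = IsEquivalence ≈-equiv

  data _▷*_ (x y : X) : Set (ℓ₁ Level.⊔ ℓ) where
    done : x ≈ y → x ▷* y
    step : ∀ {z} → x ▷ z → z ▷* y → x ▷* y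

  Normal : X → Set (ℓ₁ Level.⊔ ℓ)
  Normal x = ∀ y → ¬ x ▷ y

  ▷*-resp : ∀ {x x′ y} → x ≈ x′ → x ▷* y → x′ ▷* y
  ▷*-resp e (done e′)  = done (E.trans (E.sym e) e′)
  ▷*-resp e (step s r) = step (resp e s) r

  ▷*-closed : ∀ {x y} → (∀ {x y} → x ≈ y → P x → P y) → P x → x ▷* y → P y
  ▷*-closed inv p (done e)   = inv e p
  ▷*-closed inv p (step s r) = ▷*-closed inv (closed p s) r

  ▷*-trans : ∀ {x y z} → x ▷* y → y ▷* z → x ▷* z
  ▷*-trans (done e)   r′ = ▷*-resp (E.sym e) r′
  ▷*-trans (step s r) r′ = step s (▷*-trans r r′)

  -- The diamond closes with one step on each side, so the step `s` can be pushed along the given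
  -- reduction to `n`, by induction on its length. It must disappear on the way, since `n` is
  -- normal.
  strip : ∀ {x y n} → P x → Normal n → x ▷ y → x ▷* n → y ▷* n
  strip p nf s (done e) = contradiction (resp e s) (nf _)
  strip p nf s (step s′ r) with diamond p s s′
  ... | inj₁ e            = ▷*-resp (E.sym e) r
  ... | inj₂ (w , t , t′) = step t (strip (closed p s′) nf t′ r)

  normal-unique : ∀ {x n n′} → P x → Normal n → Normal n′ → x ▷* n → x ▷* n′ → n ≈ n′
  normal-unique p nf nf′ (done e)   (done e′)  = E.trans (E.sym e) e′
  normal-unique p nf nf′ (step s r) (done e′)  = contradiction (resp e′ s) (nf′ _)
  normal-unique p nf nf′ r          (step s r′) = normal-unique (closed p s) nf nf′ (strip p nf s r) r′

  normalising : (μ : X → ℕ) → (∀ {x y} → P x → x ▷ y → μ y < μ x) →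
                ∀ x → P x → ¬ ¬ ∃ λ n → x ▷* n × P n × Normal n
  normalising μ μ-< x p = go x p (<-wellFounded (μ x))
    where
    go : ∀ x → P x → Acc _<_ (μ x) → ¬ ¬ ∃ λ n → x ▷* n × P n × Normal n
    go x p (acc rs) = ¬¬-excluded-middle {A = ∃ (x ▷_)} >>= λ where
      (no ¬s)       → return (x , done E.refl , p , λ y s → ¬s (y , s))
      (yes (y , s)) → go y (closed p s) (rs (μ-< p s)) >>= λ (n , r , pn , nf) →
        return (n , step s r , pn , nf)

-- Both directions of the relation are terminating and have the diamond
-- property, so every component contains one normal and one conormal class.
module _ {X : Set ℓ₁} {_≈_ : Rel X 0ℓ} (≈-equiv : IsEquivalence _≈_)
  (P : X → Set ℓ₂) (P-resp : Invariant ≈-equiv P) {ℓ : Level} (_▷_ : Rel X ℓ)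
  (respˡ     : ∀ {x x′ y} → x ≈ x′ → x ▷ y → x′ ▷ y)
  (respʳ     : ∀ {x y y′} → y ≈ y′ → x ▷ y → x ▷ y′)
  (closed    : ∀ {x y} → P x → x ▷ y → P y)
  (coclosed  : ∀ {x y} → P y → x ▷ y → P x)
  (diamond   : ∀ {x y z} → P x → x ▷ y → x ▷ z → y ≈ z ⊎ ∃ λ w → (y ▷ w) × (z ▷ w))
  (codiamond : ∀ {x y z} → P x → y ▷ x → z ▷ x → y ≈ z ⊎ ∃ λ w → (w ▷ y) × (w ▷ z))
  (μ ν : X → ℕ)
  (μ-< : ∀ {x y} → P x → x ▷ y → μ y < μ x)
  (ν-< : ∀ {x y} → P y → x ▷ y → ν x < ν y)
  where

  private
    module E = IsEquivalence ≈-equiv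
    module F = Rewriting ≈-equiv P _▷_ respˡ closed diamond
    module B = Rewriting ≈-equiv P (flip _▷_) respʳ (λ p s → coclosed p s) codiamond

    backward : ∀ {x y} → x F.▷* y → y B.▷* x
    backward (F.done e)   = B.done (E.sym e)
    backward (F.step s r) = B.▷*-trans (backward r) (B.step s (B.done E.refl))

    forward : ∀ {x y} → x B.▷* y → y F.▷* x
    forward (B.done e)   = F.done (E.sym e)
    forward (B.step s r) = F.▷*-trans (forward r) (F.step s (F.done E.refl))

  -- A normal class is related to the conormal class found by running backwards. Two normal classes
  -- with equivalent ends are both reached forwards from one element, hence agree; the other
  -- inequality is the mirror image.
  size-normal-conormal : ∀ {m n} →
    Size _≈_ (λ x → P x × F.Normal x) m → Size _≈_ (λ x → P x × B.Normal x) n → m ≡ n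
  size-normal-conormal S T = ℕₚ.≤-antisym
    (size-≤ ≈-equiv ≈-equiv B._▷*_
      (λ x (p , _) → B.normalising ν ν-< x p >>= λ (n , r , q , nf) → return (n , (q , nf) , r))
      (λ (p , nf) (p′ , nf′) r r′ e →
        F.normal-unique (B.▷*-closed P-resp p r) nf nf′ (forward r) (F.▷*-resp (E.sym e) (forward r′)))
      S T)
    (size-≤ ≈-equiv ≈-equiv F._▷*_
      (λ x (p , _) → F.normalising μ μ-< x p >>= λ (n , r , q , nf) → return (n , (q , nf) , r))
      (λ (p , nf) (p′ , nf′) r r′ e →
        B.normal-unique (F.▷*-closed P-resp p r) nf nf′ (backward r) (B.▷*-resp (E.sym e) (backward r′)))
      T S)

lookup-injective : ∀ {A : Set} {xs : List A} → Unique xs → ∀ {i j} → lookup xs i ≡ lookup xs j → i ≡ j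
lookup-injective (_ ∷ _)   {zero}  {zero}  _  = refl
lookup-injective (x∉ ∷ _)  {zero}  {suc j} eq = contradiction eq (All.lookup x∉ (∈-lookup j))
lookup-injective (x∉ ∷ _)  {suc i} {zero}  eq = contradiction (sym eq) (All.lookup x∉ (∈-lookup i))
lookup-injective (_ ∷ xs!) {suc i} {suc j} eq = cong suc (lookup-injective xs! eq)

module _ {n} {P : Fin n → Set} (P? : Decidable P) where

  pick : Fin (count P?) → Fin n
  pick = lookup (select P?)

  pick-holds : ∀ h → P (pick h)
  pick-holds h = proj₂ (∈-filter⁻ P? {xs = allFin n} (∈-lookup h))

  pick-injective : ∀ {h h′} → pick h ≡ pick h′ → h ≡ h′
  pick-injective = lookup-injective (filter⁺ P? (allFin⁺ n))

  pick-onto : ∀ {x} → P x → ∃ λ h → pick h ≡ x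
  pick-onto {x} p = index x∈ , sym (lookup-index x∈)
    where x∈ = ∈-filter⁺ P? (∈-allFin x) p

-- Irrelevance of `holds` makes elements equal as soon as their points are, although the predicates
-- in use are function types.
record Sub (V : Set) (P : V → Set) : Set where
  constructor _,,_
  field
    point  : V
    .holds : P point
open Sub public

Sub-≡ : ∀ {V : Set} {P : V → Set} {x y : Sub V P} → point x ≡ point y → x ≡ y
Sub-≡ {x = _ ,, _} {_ ,, _} refl = refl

-- abstract, since comparing unfolded enumerations of collapsed graphs is infeasible.
abstract
  enumerate-Sub : ∀ {V : Set} {n} → V ↔ Fin n → {P : V → Set} → Decidable P → ∃ λ m → Sub V P ↔ Fin m
  enumerate-Sub {V} {n} e {P} P? = count Q? , mk↔ₛ′ to from
    (λ h → pick-injective Q? (trans (proj₂ (pick-onto Q? _)) (E.strictlyInverseˡ _)))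
    (λ x → Sub-≡ (trans (cong E.from (proj₂ (pick-onto Q? _))) (E.strictlyInverseʳ (point x))))
    where
    module E = Inverse e
    Q? : Decidable (P ∘ E.from)
    Q? = P? ∘ E.from
    to : Sub V P → Fin (count Q?)
    to (x ,, p) = proj₁ (pick-onto Q? (subst P (sym (E.strictlyInverseʳ x)) (recompute (P? x) p)))
    from : Fin (count Q?) → Sub V P
    from h = E.from (pick Q? h) ,, pick-holds Q? h

-- Coloured graphs

data Kind : Set where
  sibling pendant : Kind

isSibling : Kind → Bool
isSibling sibling = true
isSibling pendant = false

-- An enumerated type of vertices, instead of `Fin size`, makes an expansion a sum type and a
-- collapse a subtype. Isomorphisms between iterated constructions are then given by pattern
-- matching, with no renumbering.
record ColouredGraph (C : Set) : Set₁ where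
  field
    V           : Set
    size        : ℕ
    enum        : V ↔ Fin size
    edge        : V → V → Bool
    edge-sym    : ∀ u v → edge u v ≡ edge v u
    edge-irrefl : ∀ v → edge v v ≡ false
    colour      : V → C

  open Inverse enum public using () renaming
    (to to position; from to vertex; strictlyInverseˡ to position-vertex; strictlyInverseʳ to vertex-position)

  position-injective : ∀ {u v} → position u ≡ position v → u ≡ v
  position-injective {u} {v} eq =
    trans (sym (vertex-position u)) (trans (cong vertex eq) (vertex-position v))

  infix 4 _≟_ _==_
  _≟_ : (u v : V) → Dec (u ≡ v)
  u ≟ v = map′ position-injective (cong position) (position u Finₚ.≟ position v)

  _==_ : V → V → Bool
  u == v = does (u ≟ v)

  ==-refl : ∀ v → (v == v) ≡ true
  ==-refl v = dec-true (v ≟ v) refl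

  ==-≢ : ∀ {u v} → u ≢ v → (u == v) ≡ false
  ==-≢ {u} {v} = dec-false (u ≟ v)

  ==-sym : ∀ u v → (u == v) ≡ (v == u)
  ==-sym u v = does-⇔ (mk⇔ sym sym) (u ≟ v) (v ≟ u)

  search : {P : V → Set} → (∀ v → Dec (P v)) → Dec (∃ P)
  search {P} P? = map′ (λ (i , p) → vertex i , p)
    (λ (v , p) → position v , subst P (sym (vertex-position v)) p) (Finₚ.any? (P? ∘ vertex))

  closed : V → V → Bool
  closed u v = (u == v) ∨ edge u v

  closed-sym : ∀ u v → closed u v ≡ closed v u
  closed-sym u v = cong₂ _∨_ (==-sym u v) (edge-sym u v)

  closed-refl : ∀ v → closed v v ≡ true
  closed-refl v = cong (_∨ edge v v) (==-refl v)

  closed-≢ : ∀ {u v} → u ≢ v → closed u v ≡ edge u v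
  closed-≢ {u} {v} u≢v = cong (_∨ edge u v) (==-≢ u≢v)

  repaint : V → C → V → C
  repaint v c u = if v == u then c else colour u

  repaint-≡ : ∀ v c u → v ≡ u → repaint v c u ≡ c
  repaint-≡ v c u v≡u = cong (if_then c else colour u) (dec-true (v ≟ u) v≡u)

  repaint-≢ : ∀ v c u → v ≢ u → repaint v c u ≡ colour u
  repaint-≢ v c u v≢u = cong (if_then c else colour u) (==-≢ v≢u)

  -- The neighbourhood of a vertex that is attached to v.
  link : Kind → V → V → Bool
  link sibling v w = closed v w
  link pendant v w = v == w

  -- For `sibling` this says that `x` and `v` have the same closed neighbourhood, for `pendant` that
  -- `x` is a leaf at `v`. The common form lets one argument serve both kinds in expansions and
  -- collapses.
  Attached : Kind → V → V → Set
  Attached k x v = x ≢ v × (∀ w → w ≢ x → edge x w ≡ link k v w)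

  link-refl : ∀ k v → link k v v ≡ true
  link-refl sibling = closed-refl
  link-refl pendant = ==-refl

  attached-edge : ∀ {k x v} → Attached k x v → edge x v ≡ true
  attached-edge {k} {x} {v} (x≢v , a) = trans (a v (x≢v ∘ sym)) (link-refl k v)

  link-attached : ∀ {k x v} → Attached k x v → link k v x ≡ isSibling k
  link-attached {sibling} {x} {v} a@(x≢v , _) =
    trans (closed-≢ (x≢v ∘ sym)) (trans (edge-sym v x) (attached-edge {sibling} a))
  link-attached {pendant} (x≢v , _) = ==-≢ (x≢v ∘ sym)

  attached-closed : ∀ {x v} → Attached sibling x v → ∀ w → closed x w ≡ closed v w
  attached-closed {x} {v} a@(_ , e) w with w ≟ x
  ... | yes refl = trans (closed-refl w) (sym (link-attached {sibling} a))
  ... | no w≢x   = trans (closed-≢ (w≢x ∘ sym)) (e w w≢x)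

  closed-attached : ∀ {x v} → x ≢ v → (∀ w → closed x w ≡ closed v w) → Attached sibling x v
  closed-attached x≢v e = x≢v , λ w w≢x → trans (sym (closed-≢ (w≢x ∘ sym))) (e w)

  pendant-edge : ∀ {x v} → Attached pendant x v → ∀ w → edge x w ≡ (v == w)
  pendant-edge {x} {v} a@(x≢v , e) w with w ≟ x
  ... | yes refl = trans (edge-irrefl w) (sym (link-attached {pendant} a))
  ... | no w≢x   = e w w≢x

  edge-attached : ∀ {x v} → (∀ w → edge x w ≡ (v == w)) → Attached pendant x v
  edge-attached {x} {v} e = x≢v , λ w _ → e w
    where
    x≢v : x ≢ v
    x≢v refl with trans (sym (edge-irrefl x)) (trans (e x) (==-refl x))
    ... | ()

  -- A group of `d + 1` vertices that may be merged: `base` survives and the `d` members vanish.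
  -- Among siblings any vertex may act as base; in the pendant case the base carries the leaves.
  record Spot (k : Kind) (d : ℕ) : Set where
    field
      member    : Fin d → V
      injective : ∀ {i j} → member i ≡ member j → i ≡ j
      base      : V
      attached  : ∀ i → Attached k (member i) base
      same      : ∀ i → colour (member i) ≡ colour base

    ≢base : ∀ i → member i ≢ base
    ≢base i = proj₁ (attached i)

    shade : C
    shade = colour base

  IsConnected : Set
  IsConnected = V × (∀ u v → Star (λ u v → edge u v ≡ true) u v)

  total : (C → ℕ) → ℕ
  total f = sum {size} λ i → f (colour (vertex i))

infix 4 _≃_
record _≃_ {C : Set} (G H : ColouredGraph C) : Set where
  private
    module G = ColouredGraph G
    module H = ColouredGraph H
  field
    to      : G.V → H.V
    from    : H.V → G.V
    to-from : ∀ v → to (from v) ≡ v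
    from-to : ∀ u → from (to u) ≡ u
    edges   : ∀ u v → H.edge (to u) (to v) ≡ G.edge u v
    colours : ∀ u → H.colour (to u) ≡ G.colour u

  to-injective : ∀ {u v} → to u ≡ to v → u ≡ v
  to-injective {u} {v} eq = trans (sym (from-to u)) (trans (cong from eq) (from-to v))

  to-== : ∀ u v → (to u H.== to v) ≡ (u G.== v)
  to-== u v = does-⇔ (mk⇔ to-injective (cong to)) (to u H.≟ to v) (u G.≟ v)

  to-link : ∀ k u v → H.link k (to u) (to v) ≡ G.link k u v
  to-link sibling u v = cong₂ _∨_ (to-== u v) (edges u v)
  to-link pendant u v = to-== u v

  to-repaint : ∀ v c u → H.repaint (to v) c (to u) ≡ G.repaint v c u
  to-repaint v c u = cong₂ (if_then c else_) (to-== v u) (colours u)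

≃-refl : ∀ {C} {G : ColouredGraph C} → G ≃ G
≃-refl = record { to = id ; from = id ; to-from = λ _ → refl ; from-to = λ _ → refl
                ; edges = λ _ _ → refl ; colours = λ _ → refl }

≃-sym : ∀ {C} {G H : ColouredGraph C} → G ≃ H → H ≃ G
≃-sym {G = G} {H} φ = record
  { to = φ.from ; from = φ.to ; to-from = φ.from-to ; from-to = φ.to-from
  ; edges = λ u v → trans (sym (φ.edges _ _)) (cong₂ (ColouredGraph.edge H) (φ.to-from u) (φ.to-from v))
  ; colours = λ u → trans (sym (φ.colours _)) (cong (ColouredGraph.colour H) (φ.to-from u)) }
  where module φ = _≃_ φ

≃-trans : ∀ {C} {G H K : ColouredGraph C} → G ≃ H → H ≃ K → G ≃ K
≃-trans φ ψ = record
  { to = ψ.to ∘ φ.to ; from = φ.from ∘ ψ.from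
  ; to-from = λ v → trans (cong ψ.to (φ.to-from _)) (ψ.to-from v)
  ; from-to = λ v → trans (cong φ.from (ψ.from-to _)) (φ.from-to v)
  ; edges = λ u v → trans (ψ.edges _ _) (φ.edges u v)
  ; colours = λ u → trans (ψ.colours _) (φ.colours u) }
  where
  module φ = _≃_ φ
  module ψ = _≃_ ψ

≃-equiv : ∀ {C} → IsEquivalence (_≃_ {C})
≃-equiv = record { refl = ≃-refl ; sym = ≃-sym ; trans = ≃-trans }

-- Expanding a vertex and collapsing a group

module _ {C : Set} (k : Kind) (d : ℕ) (G : ColouredGraph C) where
  open ColouredGraph G

  -- The inverse of merging: v, which stood for a whole group, becomes one of its
  -- d + 1 members of colour c.
  expand : V → C → ColouredGraph C
  expand v c = record
    { V           = Fin d ⊎ V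
    ; size        = d + size
    ; enum        = Compose.inverse (Inverse-refl ⊎-↔ enum) (Symmetry.inverse Finₚ.+↔⊎)
    ; edge        = edge′
    ; edge-sym    = edge′-sym
    ; edge-irrefl = edge′-irrefl
    ; colour      = λ { (inj₁ i) → c ; (inj₂ u) → repaint v c u }
    }
    where
    Inverse-refl : Fin d ↔ Fin d
    Inverse-refl = mk↔ₛ′ id id (λ _ → refl) (λ _ → refl)
    edge′ : Fin d ⊎ V → Fin d ⊎ V → Bool
    edge′ (inj₁ i) (inj₁ j) = isSibling k ∧ not (does (i Finₚ.≟ j))
    edge′ (inj₁ i) (inj₂ u) = link k v u
    edge′ (inj₂ u) (inj₁ i) = link k v u
    edge′ (inj₂ u) (inj₂ w) = edge u w
    edge′-sym : ∀ x y → edge′ x y ≡ edge′ y x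
    edge′-sym (inj₁ i) (inj₁ j) = cong (λ b → isSibling k ∧ not b)
      (does-⇔ (mk⇔ sym sym) (i Finₚ.≟ j) (j Finₚ.≟ i))
    edge′-sym (inj₁ i) (inj₂ u) = refl
    edge′-sym (inj₂ u) (inj₁ i) = refl
    edge′-sym (inj₂ u) (inj₂ w) = edge-sym u w
    edge′-irrefl : ∀ x → edge′ x x ≡ false
    edge′-irrefl (inj₁ i) = trans (cong (λ b → isSibling k ∧ not b) (dec-true (i Finₚ.≟ i) refl)) (Boolₚ.∧-zeroʳ _)
    edge′-irrefl (inj₂ u) = edge-irrefl u

expand-cong : ∀ {C k d} {G H : ColouredGraph C} (φ : G ≃ H) {v c} →
              expand k d G v c ≃ expand k d H (_≃_.to φ v) c
expand-cong {C} {k} {d} {G} {H} φ {v} {c} = record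
  { to = Sum.map₂ φ.to ; from = Sum.map₂ φ.from
  ; to-from = [ (λ _ → refl) , (λ u → cong inj₂ (φ.to-from u)) ]
  ; from-to = [ (λ _ → refl) , (λ u → cong inj₂ (φ.from-to u)) ]
  ; edges = λ where
      (inj₁ i) (inj₁ j) → refl
      (inj₁ i) (inj₂ u) → φ.to-link k v u
      (inj₂ u) (inj₁ i) → φ.to-link k v u
      (inj₂ u) (inj₂ w) → φ.edges u w
  ; colours = λ where
      (inj₁ i) → refl
      (inj₂ u) → φ.to-repaint v c u
  }
  where module φ = _≃_ φ

module _ {C : Set} where
  open ColouredGraph

  expand-link : ∀ {k d} (G : ColouredGraph C) {v c} k′ u w →
                link (expand k d G v c) k′ (inj₂ u) (inj₂ w) ≡ link G k′ u w
  expand-link {k} {d} G {v} {c} k′ u w = go k′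
    where
    E = expand k d G v c
    same : _==_ E (inj₂ u) (inj₂ w) ≡ _==_ G u w
    same = does-⇔ (mk⇔ (λ { refl → refl }) (cong inj₂)) (_≟_ E (inj₂ u) (inj₂ w)) (_≟_ G u w)
    go : ∀ k′ → link E k′ (inj₂ u) (inj₂ w) ≡ link G k′ u w
    go sibling = cong (_∨ edge G u w) same
    go pendant = same

  -- A vertex attached to `u` meets the new vertices at `v` only if both kinds are `sibling` and
  -- `u`, `v` are adjacent. This condition is symmetric in the two kinds, which is why expansions at
  -- different vertices commute.
  expand-link-new : ∀ {k d} (G : ColouredGraph C) {v c} k′ {u} i → v ≢ u →
                    link (expand k d G v c) k′ (inj₂ u) (inj₁ i) ≡ isSibling k′ ∧ (isSibling k ∧ edge G v u)
  expand-link-new {k} {d} G {v} {c} k′ {u} i v≢u = go k′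
    where
    E = expand k d G v c
    new : _==_ E (inj₂ u) (inj₁ i) ≡ false
    new = ==-≢ E {inj₂ u} {inj₁ i} λ ()
    link-≢ : ∀ k → link G k v u ≡ isSibling k ∧ edge G v u
    link-≢ sibling = closed-≢ G v≢u
    link-≢ pendant = ==-≢ G v≢u
    go : ∀ k′ → link E k′ (inj₂ u) (inj₁ i) ≡ isSibling k′ ∧ (isSibling k ∧ edge G v u)
    go sibling = trans (cong (_∨ link G k v u) new) (link-≢ k)
    go pendant = new

  expand-swap : ∀ {k k′ d d′} (G : ColouredGraph C) {v v′ c c′} → v ≢ v′ →
                expand k d (expand k′ d′ G v′ c′) (inj₂ v) c ≃ expand k′ d′ (expand k d G v c) (inj₂ v′) c′
  expand-swap {k} {k′} {d} {d′} G {v} {v′} {c} {c′} v≢v′ = record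
    { to = swap ; from = swap
    ; to-from = λ { (inj₁ _) → refl ; (inj₂ (inj₁ _)) → refl ; (inj₂ (inj₂ _)) → refl }
    ; from-to = λ { (inj₁ _) → refl ; (inj₂ (inj₁ _)) → refl ; (inj₂ (inj₂ _)) → refl }
    ; edges = λ where
        (inj₁ i)        (inj₁ j)        → refl
        (inj₁ i)        (inj₂ (inj₁ j)) → new j i
        (inj₁ i)        (inj₂ (inj₂ w)) → sym (expand-link G k v w)
        (inj₂ (inj₁ i)) (inj₁ j)        → new i j
        (inj₂ (inj₂ u)) (inj₁ j)        → sym (expand-link G k v u)
        (inj₂ (inj₁ i)) (inj₂ (inj₁ j)) → refl
        (inj₂ (inj₁ i)) (inj₂ (inj₂ w)) → expand-link G k′ v′ w
        (inj₂ (inj₂ u)) (inj₂ (inj₁ j)) → expand-link G k′ v′ u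
        (inj₂ (inj₂ u)) (inj₂ (inj₂ w)) → refl
    ; colours = λ where
        (inj₁ i)        → repaint-≢ B (inj₂ v′) c′ (inj₁ i) λ ()
        (inj₂ (inj₁ i)) → sym (repaint-≢ A (inj₂ v) c (inj₁ i) λ ())
        (inj₂ (inj₂ u)) → colours u
    }
    where
    A = expand k′ d′ G v′ c′
    B = expand k d G v c
    swap : ∀ {X Y Z : Set} → X ⊎ (Y ⊎ Z) → Y ⊎ (X ⊎ Z)
    swap (inj₁ x)        = inj₂ (inj₁ x)
    swap (inj₂ (inj₁ y)) = inj₁ y
    swap (inj₂ (inj₂ z)) = inj₂ (inj₂ z)
    ∧-swap : ∀ x y z → x ∧ (y ∧ z) ≡ y ∧ (x ∧ z)
    ∧-swap true  y z = refl
    ∧-swap false y z = sym (Boolₚ.∧-zeroʳ y)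
    new : ∀ i j → link B k′ (inj₂ v′) (inj₁ j) ≡ link A k (inj₂ v) (inj₁ i)
    new i j = trans (expand-link-new G k′ j v≢v′) (trans (∧-swap (isSibling k′) (isSibling k) _)
      (trans (cong (λ b → isSibling k ∧ (isSibling k′ ∧ b)) (edge-sym G v v′))
             (sym (expand-link-new G k i (v≢v′ ∘ sym)))))
    inj₂-≢ : ∀ {X : Set} {x y : V G} → x ≢ y → _≢_ {A = X ⊎ V G} (inj₂ x) (inj₂ y)
    inj₂-≢ x≢y refl = x≢y refl
    colours : ∀ u → repaint B (inj₂ v′) c′ (inj₂ u) ≡ repaint A (inj₂ v) c (inj₂ u)
    colours u with _≟_ G v u | _≟_ G v′ u
    ... | yes v≡u | yes v′≡u = contradiction (trans v≡u (sym v′≡u)) v≢v′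
    ... | yes v≡u | no v′≢u  = trans (repaint-≢ B (inj₂ v′) c′ (inj₂ u) (inj₂-≢ v′≢u))
      (trans (repaint-≡ G v c u v≡u) (sym (repaint-≡ A (inj₂ v) c (inj₂ u) (cong inj₂ v≡u))))
    ... | no v≢u  | yes v′≡u = trans (repaint-≡ B (inj₂ v′) c′ (inj₂ u) (cong inj₂ v′≡u))
      (sym (trans (repaint-≢ A (inj₂ v) c (inj₂ u) (inj₂-≢ v≢u)) (repaint-≡ G v′ c′ u v′≡u)))
    ... | no v≢u  | no v′≢u  = trans (repaint-≢ B (inj₂ v′) c′ (inj₂ u) (inj₂-≢ v′≢u))
      (trans (repaint-≢ G v c u v≢u)
             (sym (trans (repaint-≢ A (inj₂ v) c (inj₂ u) (inj₂-≢ v≢u)) (repaint-≢ G v′ c′ u v′≢u))))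

  -- New vertices correspond to new ones, so the isomorphism restricts to the old ones. The
  -- expansion has overwritten the colours of `v` and `w`; their equality has to be supplied from
  -- outside.
  expand-cancel : ∀ {k k′ d d′} {G H : ColouredGraph C} {v w c c′} →
                  (φ : expand k d G v c ≃ expand k′ d′ H w c′) →
                  (f : Fin d → Fin d′) (g : Fin d′ → Fin d) →
                  (∀ i → _≃_.to φ (inj₁ i) ≡ inj₁ (f i)) → (∀ i → _≃_.from φ (inj₁ i) ≡ inj₁ (g i)) →
                  _≃_.to φ (inj₂ v) ≡ inj₂ w → colour G v ≡ colour H w → G ≃ H
  expand-cancel {k} {k′} {d} {d′} {G} {H} {v} {w} {c} {c′} φ f g to-new from-new base shade = record
    { to = proj₁ ∘ to-old ; from = proj₁ ∘ from-old
    ; to-from = λ y → inj₂-inj (trans (sym (proj₂ (to-old _))) (trans (cong φ.to (sym (proj₂ (from-old y)))) (φ.to-from (inj₂ y))))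
    ; from-to = λ x → inj₂-inj (trans (sym (proj₂ (from-old _))) (trans (cong φ.from (sym (proj₂ (to-old x)))) (φ.from-to (inj₂ x))))
    ; edges = λ x y → trans (cong₂ (edge (expand k′ d′ H w c′)) (sym (proj₂ (to-old x))) (sym (proj₂ (to-old y))))
                            (φ.edges (inj₂ x) (inj₂ y))
    ; colours = colours }
    where
    module φ = _≃_ φ
    inj₂-inj : ∀ {X Y : Set} {x y : Y} → inj₂ {A = X} x ≡ inj₂ y → x ≡ y
    inj₂-inj refl = refl
    to-old : ∀ x → ∃ λ y → φ.to (inj₂ x) ≡ inj₂ y
    to-old x with φ.to (inj₂ x) in eq
    ... | inj₂ y = y , refl
    ... | inj₁ j with trans (sym (φ.from-to (inj₂ x))) (trans (cong φ.from eq) (from-new j))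
    ...   | ()
    from-old : ∀ y → ∃ λ x → φ.from (inj₂ y) ≡ inj₂ x
    from-old y with φ.from (inj₂ y) in eq
    ... | inj₂ x = x , refl
    ... | inj₁ i with trans (sym (φ.to-from (inj₂ y))) (trans (cong φ.to eq) (to-new i))
    ...   | ()
    to-base : proj₁ (to-old v) ≡ w
    to-base = inj₂-inj (trans (sym (proj₂ (to-old v))) base)
    colours : ∀ x → colour H (proj₁ (to-old x)) ≡ colour G x
    colours x with _≟_ G v x
    ... | yes refl = trans (cong (colour H) to-base) (sym shade)
    ... | no v≢x   = trans (sym (repaint-≢ H w c′ _ w≢))
      (trans (cong (colour (expand k′ d′ H w c′)) (sym (proj₂ (to-old x))))
             (trans (φ.colours (inj₂ x)) (repaint-≢ G v c x v≢x)))
      where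
      w≢ : w ≢ proj₁ (to-old x)
      w≢ eq = v≢x (inj₂-inj (φ.to-injective (trans base (trans (cong inj₂ eq) (sym (proj₂ (to-old x)))))))

  module _ (G : ColouredGraph C) {k d} (s : Spot G k d) where
    open Spot s

    Outside : V G → Set
    Outside x = ∀ i → member i ≢ x

    outside? : ∀ x → (∃ λ i → member i ≡ x) ⊎ Outside x
    outside? x with Finₚ.any? (λ i → _≟_ G (member i) x)
    ... | yes p = inj₁ p
    ... | no ¬p = inj₂ λ i e → ¬p (i , e)

    collapse : C → ColouredGraph C
    collapse c = record
      { V           = Sub (V G) Outside
      ; size        = proj₁ finite
      ; enum        = proj₂ finite
      ; edge        = λ u w → edge G (point u) (point w)
      ; edge-sym    = λ u w → edge-sym G (point u) (point w)
      ; edge-irrefl = λ u → edge-irrefl G (point u)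
      ; colour      = λ u → repaint G base c (point u)
      }
      where finite = enumerate-Sub (enum G) λ x → Finₚ.all? λ i → ¬? (_≟_ G (member i) x)

    module _ {c : C} where

      base′ : V (collapse c)
      base′ = base ,, λ i → ≢base i

      collapse-link : ∀ k u w → link (collapse c) k u w ≡ link G k (point u) (point w)
      collapse-link k u w = go k
        where
        same′ : _==_ (collapse c) u w ≡ _==_ G (point u) (point w)
        same′ = does-⇔ (mk⇔ (cong point) (Sub-≡ {P = Outside} {u} {w})) (_≟_ (collapse c) u w) (_≟_ G (point u) (point w))
        go : ∀ k → link (collapse c) k u w ≡ link G k (point u) (point w)
        go sibling = cong (_∨ edge G (point u) (point w)) same′
        go pendant = same′

      -- Attachment determines every edge at a member from the base alone, so the group can be
      -- rebuilt from its base and its common colour.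
      expand-collapse : expand k d (collapse c) base′ shade ≃ G
      expand-collapse = record
        { to = to ; from = λ x → from (outside? x)
        ; to-from = λ x → to-from (outside? x)
        ; from-to = λ { (inj₁ i) → from-member i (outside? (member i)) ; (inj₂ u) → from-point u (outside? (point u)) }
        ; edges = λ where
            (inj₁ i) (inj₁ j) → members i j
            (inj₁ i) (inj₂ u) → crossing i u
            (inj₂ u) (inj₁ i) → trans (edge-sym G _ _) (crossing i u)
            (inj₂ u) (inj₂ w) → refl
        ; colours = λ { (inj₁ i) → same i ; (inj₂ u) → colours u }
        }
        where
        to : Fin d ⊎ V (collapse c) → V G
        to (inj₁ i) = member i
        to (inj₂ u) = point u
        from : ∀ {x} → (∃ λ i → member i ≡ x) ⊎ Outside x → Fin d ⊎ V (collapse c)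
        from     (inj₁ (i , _)) = inj₁ i
        from {x} (inj₂ o)       = inj₂ (x ,, o)
        to-from : ∀ {x} (o : (∃ λ i → member i ≡ x) ⊎ Outside x) → to (from o) ≡ x
        to-from (inj₁ (i , e)) = e
        to-from (inj₂ o)       = refl
        from-member : ∀ i (o : (∃ λ j → member j ≡ member i) ⊎ Outside (member i)) → from o ≡ inj₁ i
        from-member i (inj₁ (j , e)) = cong inj₁ (injective e)
        from-member i (inj₂ o)       = contradiction refl (o i)
        from-point : ∀ u (o : (∃ λ j → member j ≡ point u) ⊎ Outside (point u)) → from o ≡ inj₂ u
        from-point (_ ,, out) (inj₁ (j , e)) = ⊥-elim-irr (out j e)
        from-point u (inj₂ o)       = refl
        members : ∀ i j → edge G (member i) (member j) ≡ isSibling k ∧ not (does (i Finₚ.≟ j))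
        members i j with i Finₚ.≟ j
        ... | yes refl = trans (edge-irrefl G _) (sym (Boolₚ.∧-zeroʳ _))
        ... | no i≢j   = trans (proj₂ (attached i) (member j) (λ e → i≢j (sym (injective e))))
                           (trans (link-attached G {k} (attached j)) (sym (Boolₚ.∧-identityʳ _)))
        crossing : ∀ i u → edge G (member i) (point u) ≡ link (collapse c) k base′ u
        crossing i u@(_ ,, out) = trans (proj₂ (attached i) (point u) λ e → ⊥-elim-irr (out i (sym e)))
                             (sym (collapse-link k base′ u))
        colours : ∀ u → colour G (point u) ≡ repaint (collapse c) base′ shade u
        colours u with _≟_ G base (point u)
        ... | yes e = trans (cong (colour G) (sym e)) (sym (repaint-≡ (collapse c) base′ shade u (Sub-≡ e)))
        ... | no ne = sym (trans (repaint-≢ (collapse c) base′ shade u (ne ∘ cong point)) (repaint-≢ G base c (point u) ne))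

module _ {C : Set} where
  open ColouredGraph

  to-attached : ∀ {G H : ColouredGraph C} (φ : G ≃ H) {k x v} → Attached G k x v →
                Attached H k (_≃_.to φ x) (_≃_.to φ v)
  to-attached {G} {H} φ {k} {x} {v} (x≢v , a) = x≢v ∘ φ.to-injective , λ w w≢x →
    trans (cong (edge H _) (sym (φ.to-from w)))
      (trans (φ.edges x (φ.from w))
        (trans (a (φ.from w) λ e → w≢x (trans (sym (φ.to-from w)) (cong φ.to e)))
          (trans (sym (φ.to-link k v (φ.from w))) (cong (link H k (φ.to v)) (φ.to-from w)))))
    where module φ = _≃_ φ

  to-spot : ∀ {G H : ColouredGraph C} {k d} → G ≃ H → Spot G k d → Spot H k d
  to-spot {k = k} φ s = record
    { member = φ.to ∘ member ; injective = injective ∘ φ.to-injective ; base = φ.to base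
    ; attached = λ i → to-attached φ {k} (attached i)
    ; same = λ i → trans (φ.colours _) (trans (same i) (sym (φ.colours _))) }
    where
    module φ = _≃_ φ
    open Spot s

  link-new : ∀ k d (H : ColouredGraph C) v c j → link (expand k d H v c) k (inj₂ v) (inj₁ j) ≡ isSibling k
  link-new k d H v c j = go k refl
    where
    E = expand k d H v c
    go : ∀ k′ → k′ ≡ k → link E k′ (inj₂ v) (inj₁ j) ≡ isSibling k′
    go sibling refl = trans (cong (_∨ closed H v v) (==-≢ E {inj₂ v} {inj₁ j} λ ())) (closed-refl H v)
    go pendant refl = ==-≢ E {inj₂ v} {inj₁ j} λ ()

  expand-spot : ∀ k d (H : ColouredGraph C) v c → Spot (expand k d H v c) k d
  expand-spot k d H v c = record
    { member = inj₁ ; injective = λ { refl → refl } ; base = inj₂ v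
    ; attached = λ i → (λ ()) , λ where
        (inj₁ j) ne → trans (cong (λ b → isSibling k ∧ not b) (dec-false (i Finₚ.≟ j) λ { refl → ne refl }))
                            (trans (Boolₚ.∧-identityʳ _) (sym (link-new k d H v c j)))
        (inj₂ u) _  → sym (expand-link {k = k} {d} H {v} {c} k v u)
    ; same = λ i → sym (repaint-≡ H v c v refl) }

-- Permutations carrying one family to another

record Permuting {V : Set} {d} (P : V → Set) (f g : Fin d → V) : Set where
  field
    to      : V → V
    from    : V → V
    to-from : ∀ x → to (from x) ≡ x
    from-to : ∀ x → from (to x) ≡ x
    maps    : ∀ i → to (f i) ≡ g i
    moves   : ∀ x → to x ≡ x ⊎ (P x × P (to x))

module _ {V : Set} (_≟_ : (x y : V) → Dec (x ≡ y)) {P : V → Set} where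

  private
    swap : V → V → V → V
    swap a b x with x ≟ a
    ... | yes _ = b
    ... | no _ with x ≟ b
    ...   | yes _ = a
    ...   | no _  = x

    swap-a : ∀ a b → swap a b a ≡ b
    swap-a a b with a ≟ a
    ... | yes _ = refl
    ... | no ¬p = contradiction refl ¬p

    swap-other : ∀ {a b x} → x ≢ a → x ≢ b → swap a b x ≡ x
    swap-other {a} {b} {x} x≢a x≢b with x ≟ a
    ... | yes e = contradiction e x≢a
    ... | no _ with x ≟ b
    ...   | yes e = contradiction e x≢b
    ...   | no _  = refl

    swap-b : ∀ a b → swap a b b ≡ a
    swap-b a b with b ≟ a
    ... | yes e = e
    ... | no _ with b ≟ b
    ...   | yes _ = refl
    ...   | no ¬p = contradiction refl ¬p

    swap-involutive : ∀ a b x → swap a b (swap a b x) ≡ x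
    swap-involutive a b x with x ≟ a
    ... | yes refl = swap-b x b
    ... | no x≢a with x ≟ b
    ...   | yes refl = swap-a a x
    ...   | no x≢b  = swap-other x≢a x≢b

    swap-moves : ∀ {a b} → P a → P b → ∀ x → swap a b x ≡ x ⊎ (P x × P (swap a b x))
    swap-moves {a} {b} pa pb x with x ≟ a
    ... | yes refl = inj₂ (pa , pb)
    ... | no _ with x ≟ b
    ...   | yes refl = inj₂ (pb , pa)
    ...   | no _  = inj₁ refl

  -- Match the tails first, then exchange the current image of `f zero` with `g zero`. By
  -- injectivity neither of these is some `g (suc i)`, so the earlier matches survive. Only points
  -- of `P` move, and they stay in `P`: when the points of `P` look alike, the permutation is an
  -- automorphism.
  permuting : ∀ {d} {f g : Fin d → V} → (∀ {i j} → f i ≡ f j → i ≡ j) → (∀ {i j} → g i ≡ g j → i ≡ j) →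
              (∀ i → P (f i)) → (∀ i → P (g i)) → Permuting P f g
  permuting {zero} _ _ _ _ = record
    { to = id ; from = id ; to-from = λ _ → refl ; from-to = λ _ → refl ; maps = λ () ; moves = λ _ → inj₁ refl }
  permuting {suc d} {f} {g} f-inj g-inj pf pg = record
    { to = swap a b ∘ π.to ; from = π.from ∘ swap a b
    ; to-from = λ x → trans (cong (swap a b) (π.to-from _)) (swap-involutive a b x)
    ; from-to = λ x → trans (cong π.from (swap-involutive a b _)) (π.from-to x)
    ; maps = λ { zero → swap-a a b ; (suc i) → trans (cong (swap a b) (π.maps i))
        (swap-other (λ e → 0≢suc (f-inj (π-inj (trans (π.maps i) e)))) λ e → 0≢suc (g-inj e)) }
    ; moves = λ x → moves (π.moves x) (swap-moves (pa (π.moves (f zero))) (pg zero) (π.to x)) }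
    where
    module π = Permuting (permuting {d} {f ∘ suc} {g ∘ suc} (Finₚ.suc-injective ∘ f-inj)
                           (Finₚ.suc-injective ∘ g-inj) (pf ∘ suc) (pg ∘ suc))
    a = π.to (f zero)
    b = g zero
    π-inj : ∀ {x y} → π.to x ≡ π.to y → x ≡ y
    π-inj {x} {y} e = trans (sym (π.from-to x)) (trans (cong π.from e) (π.from-to y))
    0≢suc : ∀ {n} {i : Fin n} → suc i ≢ zero
    0≢suc ()
    pa : a ≡ f zero ⊎ (P (f zero) × P a) → P a
    pa (inj₁ e)       = subst P (sym e) (pf zero)
    pa (inj₂ (_ , p)) = p
    moves : ∀ {x y} → π.to x ≡ x ⊎ (P x × P (π.to x)) → y ≡ π.to x ⊎ (P (π.to x) × P y) → y ≡ x ⊎ (P x × P y)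
    moves (inj₁ e)       (inj₁ e′)       = inj₁ (trans e′ e)
    moves (inj₁ e)       (inj₂ (p , q))  = inj₂ (subst P e p , q)
    moves (inj₂ (p , q)) (inj₁ e′)       = inj₂ (p , subst P (sym e′) q)
    moves (inj₂ (p , _)) (inj₂ (_ , q))  = inj₂ (p , q)

-- Overlapping groups in a connected graph

module _ {C : Set} (G : ColouredGraph C) where
  open ColouredGraph G

  private
    Adj : V → V → Set
    Adj u v = edge u v ≡ true

    ==⇒≡ : ∀ {u v} → (u == v) ≡ true → u ≡ v
    ==⇒≡ {u} {v} e with u ≟ v
    ... | yes p = p
    ... | no ne = contradiction (trans (sym e) (==-≢ ne)) λ ()

    vertex-injective : ∀ {i j} → vertex i ≡ vertex j → i ≡ j
    vertex-injective {i} {j} e = trans (sym (position-vertex i)) (trans (cong position e) (position-vertex j))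

  third-vertex : 3 ≤ size → ∀ u v → ∃ λ w → w ≢ u × w ≢ v
  third-vertex 3≤ u v with search (λ w → ¬? (w ≟ u) ×-dec ¬? (w ≟ v))
  ... | yes p = p
  ... | no ¬p = contradiction (Finₚ.injective⇒≤ {f = f} f-inj) λ s≤2 → contradiction (ℕₚ.≤-trans 3≤ s≤2) λ { (s≤s (s≤s ())) }
    where
    f : Fin size → Fin 2
    f i with vertex i ≟ u
    ... | yes _ = zero
    ... | no _  = suc zero
    f-inj : ∀ {i j} → f i ≡ f j → i ≡ j
    f-inj {i} {j} e with vertex i ≟ u | vertex j ≟ u
    ... | yes p | yes q = vertex-injective (trans p (sym q))
    ... | no p  | no q  = vertex-injective (trans (is-v p) (sym (is-v q)))
      where
      is-v : ∀ {x} → x ≢ u → x ≡ v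
      is-v {x} x≢u with x ≟ v
      ... | yes e = e
      ... | no x≢v = contradiction (x , x≢u , x≢v) ¬p


  twin-pendant : ∀ {x v} → Attached pendant x v → (∀ y → closed x y ≡ closed v y) → Attached pendant v x
  twin-pendant {x} {v} a@(x≢v , _) twin = edge-attached λ w → go w
    where
    go : ∀ w → edge v w ≡ (x == w)
    go w with x ≟ w | v ≟ w
    ... | yes refl | _        = trans (edge-sym v x) (trans (attached-edge {pendant} a) (sym (==-refl x)))
    ... | no x≢w   | yes refl = trans (edge-irrefl v) (sym (==-≢ x≢w))
    ... | no x≢w   | no v≢w   = trans (sym (closed-≢ v≢w)) (trans (sym (twin w)) (trans (closed-≢ x≢w)
                                  (trans (pendant-edge a w) (trans (==-≢ v≢w) (sym (==-≢ x≢w))))))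

  module _ (con : IsConnected) (3≤ : 3 ≤ size) where

    -- Two leaves attached to each other form a whole component: a walk from `u` never leaves the
    -- pair, so it cannot reach a third vertex.
    no-K₂ : ∀ {u v} → Attached pendant u v → ¬ Attached pendant v u
    no-K₂ {u} {v} a b with third-vertex 3≤ u v
    ... | w , w≢u , w≢v = [ w≢u , w≢v ] (stay (proj₂ con u w) (inj₁ refl))
      where
      stay : ∀ {x y} → Star Adj x y → x ≡ u ⊎ x ≡ v → y ≡ u ⊎ y ≡ v
      stay ε       p           = p
      stay (e ◅ r) (inj₁ refl) = stay r (inj₂ (sym (==⇒≡ (trans (sym (pendant-edge a _)) e))))
      stay (e ◅ r) (inj₂ refl) = stay r (inj₁ (sym (==⇒≡ (trans (sym (pendant-edge b _)) e))))

    no-twin-leaf : ∀ {x v} → Attached pendant x v → ¬ (∀ y → closed x y ≡ closed v y)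
    no-twin-leaf a twin = no-K₂ a (twin-pendant a twin)

    Member : ∀ {k d} → Spot k d → V → Set
    Member s w = w ≡ base ⊎ ∃ λ i → w ≡ member i
      where open Spot s

    -- How far a shared vertex determines the base: for siblings only up to twins, for pendants
    -- exactly.
    Near : Kind → V → V → Set
    Near sibling u v = ∀ w → closed u w ≡ closed v w
    Near pendant u v = u ≡ v

    private
      module _ {d} (s : Spot sibling (suc d)) where
        open Spot s

        member-twin : ∀ {w} → Member s w → ∀ x → closed w x ≡ closed base x
        member-twin (inj₁ refl)       = λ _ → refl
        member-twin (inj₂ (i , refl)) = attached-closed (attached i)

        other-twin : ∀ {w} → Member s w → ∃ λ w′ → w ≢ w′ × (∀ x → closed w x ≡ closed w′ x)
        other-twin (inj₁ refl)       = member zero , ≢base zero ∘ sym , λ x → sym (attached-closed (attached zero) x)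
        other-twin (inj₂ (i , refl)) = base , ≢base i , attached-closed (attached i)

      -- A vertex with a twin is neither a leaf nor the neighbour of one. The twin of a leaf is
      -- adjacent to it, hence is its only neighbour, and the two form K₂. A twin of the neighbour
      -- of a leaf would either be a second neighbour of that leaf or be the leaf itself.
      disjoint-kinds : ∀ {d d′} (s : Spot sibling (suc d)) (s′ : Spot pendant (suc d′)) {w} →
                       Member s w → ¬ Member s′ w
      disjoint-kinds s s′ {w} m m′ with other-twin s m
      ... | w′ , w≢w′ , twin = go m′
        where
        open Spot s′
        w~w′ : edge w w′ ≡ true
        w~w′ = trans (sym (closed-≢ w≢w′)) (trans (twin w′) (closed-refl w′))
        go : ¬ Member s′ w
        go (inj₂ (i , refl)) = no-twin-leaf (attached i) λ y → trans (twin y)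
          (cong (λ v → closed v y) (sym (==⇒≡ (trans (sym (pendant-edge (attached i) w′)) w~w′))))
        go (inj₁ refl) with w′ ≟ member zero
        ... | yes refl = no-twin-leaf (attached zero) (sym ∘ twin)
        ... | no ne    = w≢w′ (==⇒≡ (trans (sym (pendant-edge (attached zero) w′))
          (trans (edge-sym _ w′) (trans (sym (closed-≢ ne)) (trans (sym (twin _))
            (trans (closed-sym base _) (trans (closed-≢ (≢base zero)) (attached-edge {pendant} (attached zero)))))))))

    -- The kinds agree by `disjoint-kinds`, and the colours agree because groups are monochromatic.
    -- For two pendant groups the base of one is never a leaf of the other, as it would then form K₂
    -- with its own leaf; so the shared vertex is a base of both or a leaf of both.
    overlapping : ∀ {k k′ d d′} (s : Spot k (suc d)) (s′ : Spot k′ (suc d′)) {w} → Member s w → Member s′ w →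
              k ≡ k′ × Spot.shade s ≡ Spot.shade s′ × Near k (Spot.base s) (Spot.base s′)
    overlapping {k} {k′} s s′ {w} m m′ = proj₁ near , trans (sym (shade s m)) (shade s′ m′) , proj₂ near
      where
      shade : ∀ {k d} (s : Spot k d) {w} → Member s w → colour w ≡ Spot.shade s
      shade s (inj₁ refl)       = refl
      shade s (inj₂ (i , refl)) = Spot.same s i
      pendants : ∀ {d d′} (s : Spot pendant (suc d)) (s′ : Spot pendant (suc d′)) {w} →
                 Member s w → Member s′ w → Spot.base s ≡ Spot.base s′
      leaf-base : ∀ {d d′} (s : Spot pendant (suc d)) (s′ : Spot pendant d′) i → Spot.base s ≢ Spot.member s′ i
      leaf-base s s′ i refl = no-K₂ (Spot.attached s zero) (subst (Attached pendant _)
        (==⇒≡ (trans (sym (pendant-edge (Spot.attached s′ i) _)) (trans (edge-sym _ _) (attached-edge {pendant} (Spot.attached s zero)))))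
        (Spot.attached s′ i))
      pendants s s′ (inj₁ refl)       (inj₁ e)          = e
      pendants s s′ (inj₁ refl)       (inj₂ (i , e))    = contradiction e (leaf-base s s′ i)
      pendants s s′ (inj₂ (i , e))    (inj₁ refl)       = contradiction e (leaf-base s′ s i)
      pendants s s′ (inj₂ (i , refl)) (inj₂ (j , e))    = sym (==⇒≡ (trans (sym (pendant-edge (Spot.attached s′ j) _))
        (trans (cong (λ x → edge x _) (sym e)) (attached-edge {pendant} (Spot.attached s i)))))
      go : ∀ {k k′ d d′} (s : Spot k (suc d)) (s′ : Spot k′ (suc d′)) {w} → Member s w → Member s′ w →
           k ≡ k′ × Near k (Spot.base s) (Spot.base s′)
      go {sibling} {sibling} s s′ m m′ = refl , λ x → trans (sym (member-twin s m x)) (member-twin s′ m′ x)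
      go {sibling} {pendant} s s′ m m′ = contradiction m′ (disjoint-kinds s s′ m)
      go {pendant} {sibling} s s′ m m′ = contradiction m (disjoint-kinds s′ s m′)
      go {pendant} {pendant} s s′ m m′ = refl , pendants s s′ m m′
      near = go s s′ m m′

-- Merging

two-points : ∀ {C} (G : ColouredGraph C) {u v} → u ≢ v → 2 ≤ ColouredGraph.size G
two-points G {u} {v} u≢v = Finₚ.injective⇒≤ {f = λ { zero → position u ; (suc _) → position v }}
  λ { {zero} {zero} _ → refl ; {suc zero} {suc zero} _ → refl
    ; {zero} {suc zero} e → contradiction (position-injective e) u≢v
    ; {suc zero} {zero} e → contradiction (position-injective (sym e)) u≢v }
  where open ColouredGraph G

module Merging {C : Set} (d : Kind → ℕ) (ρ : Kind → C → C) where
  open ColouredGraph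

  -- Described from the result: `G` is an expansion of `H`, so the relation can be read in both
  -- directions. A merge of kind `k` replaces `d k + 2` vertices by one, and `ρ` records it in the
  -- colour.
  record Merge (G H : ColouredGraph C) : Set where
    field
      kind       : Kind
      point′     : V H
      shade      : C
      recoloured : colour H point′ ≡ ρ kind shade
      expands    : G ≃ expand kind (suc (d kind)) H point′ shade

    spot : Spot G kind (suc (d kind))
    spot = to-spot (≃-sym expands) (expand-spot kind (suc (d kind)) H point′ shade)

    spot-shade : Spot.shade spot ≡ shade
    spot-shade = trans (sym (_≃_.colours expands (_≃_.from expands (inj₂ point′))))
      (trans (cong (colour (expand kind (suc (d kind)) H point′ shade)) (_≃_.to-from expands (inj₂ point′)))
             (repaint-≡ H point′ shade point′ refl))

  merge-respˡ : ∀ {G G′ H} → G ≃ G′ → Merge G H → Merge G′ H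
  merge-respˡ φ m = record { Merge m ; expands = ≃-trans (≃-sym φ) (Merge.expands m) }

  merge-respʳ : ∀ {G H H′} → H ≃ H′ → Merge G H → Merge G H′
  merge-respʳ φ m = record
    { kind = kind ; point′ = _≃_.to φ point′ ; shade = shade
    ; recoloured = trans (_≃_.colours φ point′) recoloured
    ; expands = ≃-trans expands (expand-cong φ) }
    where open Merge m

  expand-merge : ∀ {H k v c} → colour H v ≡ ρ k c → Merge (expand k (suc (d k)) H v c) H
  expand-merge {v = v} e = record { point′ = v ; recoloured = e ; expands = ≃-refl }

  collapse-merge : ∀ {G k} (s : Spot G k (suc (d k))) {c} → c ≡ ρ k (Spot.shade s) → Merge G (collapse G s c)
  collapse-merge {G} s {c} e = record
    { point′ = base′ G s {c}
    ; recoloured = trans (repaint-≡ G base c base refl) e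
    ; expands = ≃-sym (expand-collapse G s) }
    where open Spot s

  -- An automorphism of `G` that carries one group to the other induces an isomorphism of the
  -- results. The colours of the merged vertices agree because `ρ` receives the same kind and shade.
  merge-unique : ∀ {G H H′} (m : Merge G H) (m′ : Merge G H′) (π : G ≃ G) →
                 (kinds : Merge.kind m ≡ Merge.kind m′) → Merge.shade m ≡ Merge.shade m′ →
                 (∀ i → _≃_.to π (Spot.member (Merge.spot m) i) ≡
                        Spot.member (Merge.spot m′) (subst (λ k → Fin (suc (d k))) kinds i)) →
                 _≃_.to π (Spot.base (Merge.spot m)) ≡ Spot.base (Merge.spot m′) → H ≃ H′
  merge-unique {H = H} {H′} record { kind = k ; point′ = v ; shade = c ; recoloured = r ; expands = φ }
                            record { point′ = v′ ; recoloured = r′ ; expands = φ′ } π refl refl members bases =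
    expand-cancel χ id id members′
      (λ i → trans (cong (_≃_.from χ) (sym (members′ i))) (_≃_.from-to χ (inj₁ i)))
      (trans (cong (_≃_.to φ′) bases) (_≃_.to-from φ′ (inj₂ v′))) (trans r (sym r′))
    where
    χ : expand k (suc (d k)) H v c ≃ expand k (suc (d k)) H′ v′ c
    χ = ≃-trans (≃-sym φ) (≃-trans π φ′)
    members′ : ∀ i → _≃_.to χ (inj₁ i) ≡ inj₁ i
    members′ i = trans (cong (_≃_.to φ′) (members i)) (_≃_.to-from φ′ (inj₁ i))

  -- At one vertex, injectivity of `ρ` lets the colour dictate the kind and the old shade, so the
  -- expansions coincide. At different vertices they commute.
  codiamond : (∀ {k k′ c c′} → ρ k c ≡ ρ k′ c′ → k ≡ k′ × c ≡ c′) →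
              ∀ {G G′ H} → Merge G H → Merge G′ H → G ≃ G′ ⊎ ∃ λ K → Merge K G × Merge K G′
  codiamond ρ-inj {G} {G′} {H} record { kind = k ; point′ = v ; shade = c ; recoloured = r ; expands = φ }
                               record { kind = k′ ; point′ = v′ ; shade = c′ ; recoloured = r′ ; expands = φ′ }
    with _≟_ H v v′
  ... | no v≢v′ = inj₂ (expand k (suc (d k)) B (inj₂ v) c
        , merge-respʳ (≃-sym φ) (merge-respˡ (expand-swap H (v≢v′ ∘ sym))
            (expand-merge {A} {k′} {inj₂ v′} (trans (repaint-≢ H v c v′ v≢v′) r′)))
        , merge-respʳ (≃-sym φ′) (expand-merge {B} {k} {inj₂ v} (trans (repaint-≢ H v′ c′ v (v≢v′ ∘ sym)) r)))
    where
    A = expand k (suc (d k)) H v c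
    B = expand k′ (suc (d k′)) H v′ c′
  ... | yes refl with ρ-inj (trans (sym r) r′)
  ...   | refl , refl = inj₁ (≃-trans φ (≃-sym φ′))

  module _ {G : ColouredGraph C} where

    private
      neighbourhood : Kind → V G → V G → Bool
      neighbourhood sibling = closed G
      neighbourhood pendant = edge G

      neighbourhood-sym : ∀ k u v → neighbourhood k u v ≡ neighbourhood k v u
      neighbourhood-sym sibling = closed-sym G
      neighbourhood-sym pendant = edge-sym G

      module _ {n} {P : V G → Set} {f g : Fin n → V G} (π : Permuting P f g) (k : Kind)
        (twins : ∀ {u v} → P u → P v → ∀ w → neighbourhood k u w ≡ neighbourhood k v w)
        (shades : ∀ {u v} → P u → P v → colour G u ≡ colour G v) where

        open Permuting π

        to-inj : ∀ {u v} → to u ≡ to v → u ≡ v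
        to-inj {u} {v} e = trans (sym (from-to u)) (trans (cong from e) (from-to v))

        near : ∀ u w → neighbourhood k (to u) w ≡ neighbourhood k u w
        near u w with moves u
        ... | inj₁ e       = cong (λ v → neighbourhood k v w) e
        ... | inj₂ (p , q) = twins q p w

        near₂ : ∀ u v → neighbourhood k (to u) (to v) ≡ neighbourhood k u v
        near₂ u v = trans (near u (to v)) (trans (neighbourhood-sym k u (to v))
          (trans (near v u) (neighbourhood-sym k v u)))

        near-edge : ∀ k {u v} → neighbourhood k (to u) (to v) ≡ neighbourhood k u v →
                    edge G (to u) (to v) ≡ edge G u v
        near-edge pendant e = e
        near-edge sibling {u} {v} e with _≟_ G u v
        ... | yes refl = trans (edge-irrefl G (to u)) (sym (edge-irrefl G u))
        ... | no u≢v   = trans (sym (closed-≢ G (u≢v ∘ to-inj))) (trans e (closed-≢ G u≢v))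

        automorphism : G ≃ G
        automorphism = record
          { to = to ; from = from ; to-from = to-from ; from-to = from-to
          ; edges = λ u v → near-edge k (near₂ u v)
          ; colours = shade }
          where
          shade : ∀ u → colour G (to u) ≡ colour G u
          shade u with moves u
          ... | inj₁ e       = cong (colour G) e
          ... | inj₂ (p , q) = shades q p

      -- Siblings are permuted together with the base, since the two bases may be different twins.
      -- Leaves are permuted among themselves; the base stays fixed, not being attached to itself.
      matching : ∀ {k n} (s s′ : Spot G k n) → Spot.shade s ≡ Spot.shade s′ →
        (k ≡ sibling × (∀ w → closed G (Spot.base s) w ≡ closed G (Spot.base s′) w)) ⊎
        (k ≡ pendant × Spot.base s ≡ Spot.base s′) →
        ∃ λ (φ : G ≃ G) → (∀ i → _≃_.to φ (Spot.member s i) ≡ Spot.member s′ i) ×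
                          _≃_.to φ (Spot.base s) ≡ Spot.base s′
      matching {k} {n} s s′ shades (inj₁ (refl , twin)) =
        automorphism π sibling (λ p q w → trans (proj₁ p w) (sym (proj₁ q w))) (λ p q → trans (proj₂ p) (sym (proj₂ q)))
        , maps ∘ suc , maps zero
        where
        P : V G → Set
        P u = (∀ w → closed G u w ≡ closed G (Spot.base s) w) × colour G u ≡ Spot.shade s
        class : Spot G sibling n → Fin (suc n) → V G
        class s zero    = Spot.base s
        class s (suc i) = Spot.member s i
        class-inj : ∀ s {i j} → class s i ≡ class s j → i ≡ j
        class-inj s {zero}  {zero}  e = refl
        class-inj s {zero}  {suc j} e = contradiction (sym e) (Spot.≢base s j)
        class-inj s {suc i} {zero}  e = contradiction e (Spot.≢base s i)
        class-inj s {suc i} {suc j} e = cong suc (Spot.injective s e)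
        P-s : ∀ i → P (class s i)
        P-s zero    = (λ _ → refl) , refl
        P-s (suc i) = attached-closed G (Spot.attached s i) , Spot.same s i
        P-s′ : ∀ i → P (class s′ i)
        P-s′ zero    = (λ w → sym (twin w)) , sym shades
        P-s′ (suc i) = (λ w → trans (attached-closed G (Spot.attached s′ i) w) (sym (twin w)))
                     , trans (Spot.same s′ i) (sym shades)
        π : Permuting P (class s) (class s′)
        π = permuting (_≟_ G) (class-inj s) (class-inj s′) P-s P-s′
        open Permuting π
      matching {k} {n} s s′ shades (inj₂ (refl , bases)) =
        automorphism π pendant (λ p q w → trans (pendant-edge G (proj₁ p) w) (sym (pendant-edge G (proj₁ q) w)))
                               (λ p q → trans (proj₂ p) (sym (proj₂ q)))
        , maps , [ (λ e → trans e bases) , (λ (p , _) → contradiction refl (proj₁ (proj₁ p))) ]′ (moves (Spot.base s))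
        where
        P : V G → Set
        P u = Attached G pendant u (Spot.base s) × colour G u ≡ Spot.shade s
        π : Permuting P (Spot.member s) (Spot.member s′)
        π = permuting (_≟_ G) (Spot.injective s) (Spot.injective s′)
          (λ i → Spot.attached s i , Spot.same s i)
          (λ i → subst (Attached G pendant _) (sym bases) (Spot.attached s′ i) , trans (Spot.same s′ i) (sym shades))
        open Permuting π

    record Disjoint {k k′ n n′} (s : Spot G k n) (s′ : Spot G k′ n′) : Set where
      private
        module S = Spot s
        module S′ = Spot s′
      field
        bases   : S.base ≢ S′.base
        base-   : ∀ j → S.base ≢ S′.member j
        -base   : ∀ i → S.member i ≢ S′.base
        members : ∀ i j → S.member i ≢ S′.member j

    disjoint-sym : ∀ {k k′ n n′} {s : Spot G k n} {s′ : Spot G k′ n′} → Disjoint s s′ → Disjoint s′ s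
    disjoint-sym D = record { bases = bases ∘ sym ; base- = λ i → -base i ∘ sym
                            ; -base = λ i → base- i ∘ sym ; members = λ i j → members j i ∘ sym }
      where open Disjoint D

    restrict : ∀ {k k′ n n′} (s : Spot G k n) (s′ : Spot G k′ n′) → Disjoint s s′ → ∀ c → Spot (collapse G s c) k′ n′
    restrict {k′ = k′} s s′ D c = record
      { member = λ j → S′.member j ,, λ i → members i j ; injective = S′.injective ∘ cong point
      ; base = b ; attached = λ j → S′.≢base j ∘ cong point , λ w ne →
            trans (proj₂ (S′.attached j) (point w) (λ e → ne (Sub-≡ e))) (sym (collapse-link G s k′ b w))
      ; same = λ j → trans (repaint-≢ G S.base c (S′.member j) (base- j))
          (trans (S′.same j) (sym (repaint-≢ G S.base c S′.base bases))) }
      where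
      open Disjoint D
      module S = Spot s
      module S′ = Spot s′
      b : V (collapse G s c)
      b = S′.base ,, λ i → -base i

    -- Both sides keep the same vertices and edges. Only the colours need an argument: the bases
    -- differ, so the two recolourings do not interfere.
    collapse-swap : ∀ {k k′ n n′} (s : Spot G k n) (s′ : Spot G k′ n′) (D : Disjoint s s′) (D′ : Disjoint s′ s) c c′ →
      collapse (collapse G s c) (restrict s s′ D c) c′ ≃ collapse (collapse G s′ c′) (restrict s′ s D′ c′) c
    collapse-swap s s′ D D′ c c′ = record
      { to = λ ((x ,, o) ,, o′) → (x ,, λ i e → o′ i (Sub-≡ e)) ,, λ i e → o i (cong point e)
      ; from = λ ((x ,, o) ,, o′) → (x ,, λ i e → o′ i (Sub-≡ e)) ,, λ i e → o i (cong point e)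
      ; to-from = λ _ → refl ; from-to = λ _ → refl ; edges = λ _ _ → refl
      ; colours = λ ((x ,, o) ,, o′) → shade (x ,, o) (x ,, λ i e → o′ i (Sub-≡ e)) refl }
      where
      module S = Spot s
      module S′ = Spot s′
      open Disjoint D using (bases)
      A = collapse G s c
      A′ = collapse G s′ c′
      b = Spot.base (restrict s s′ D c)
      b′ = Spot.base (restrict s′ s D′ c′)
      shade : ∀ x x′ → point x ≡ point x′ → repaint A′ b′ c x′ ≡ repaint A b c′ x
      shade x@(y ,, _) x′@(y ,, _) refl with _≟_ G S.base y | _≟_ G S′.base y
      ... | yes e | yes e′ = contradiction (trans e (sym e′)) bases
      ... | yes e | no ne′ = trans (repaint-≡ A′ b′ c x′ (Sub-≡ e))
        (sym (trans (repaint-≢ A b c′ x (ne′ ∘ cong point)) (repaint-≡ G S.base c y e)))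
      ... | no ne | yes e′ = trans (repaint-≢ A′ b′ c x′ (ne ∘ cong point))
        (trans (repaint-≡ G S′.base c′ y e′) (sym (repaint-≡ A b c′ x (Sub-≡ e′))))
      ... | no ne | no ne′ = trans (repaint-≢ A′ b′ c x′ (ne ∘ cong point)) (trans (repaint-≢ G S′.base c′ y ne′)
        (sym (trans (repaint-≢ A b c′ x (ne′ ∘ cong point)) (repaint-≢ G S.base c y ne))))

    -- Both bases survive in `K`, hence `2 ≤ size K`. As a merge removes at least one vertex, the
    -- two intermediate graphs then have at least three, and the closing merges are admissible as
    -- well.
    collapse-disjoint : ∀ {k k′} (s : Spot G k (suc (d k))) (s′ : Spot G k′ (suc (d k′))) → Disjoint s s′ →
      ∃ λ K → Merge (collapse G s (ρ k (Spot.shade s))) K × Merge (collapse G s′ (ρ k′ (Spot.shade s′))) K × 2 ≤ size K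
    collapse-disjoint {k} {k′} s s′ D = collapse (collapse G s c) t c′
      , collapse-merge {collapse G s c} {k′} t {c′} (cong (ρ k′) (sym (repaint-≢ G S.base c S′.base (Disjoint.bases D))))
      , merge-respʳ {collapse G s′ c′} {H′} {H} (≃-sym {G = H} {H′} (collapse-swap s s′ D D′ c c′)) merge′
      , two-points H {Spot.base t ,, λ j → Spot.≢base t j}
          {(S.base ,, λ i → S.≢base i) ,, λ j e → Disjoint.base- D j (sym (cong point e))}
          λ e → Disjoint.bases D (sym (cong (point ∘ point) e))
      where
      module S = Spot s
      module S′ = Spot s′
      D′ : Disjoint s′ s
      D′ = disjoint-sym D
      c = ρ k S.shade
      c′ = ρ k′ S′.shade
      t = restrict s s′ D c
      t′ = restrict s′ s D′ c′
      H = collapse (collapse G s c) t c′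
      H′ = collapse (collapse G s′ c′) t′ c
      merge′ : Merge (collapse G s′ c′) H′
      merge′ = collapse-merge {collapse G s′ c′} {k} t′ {c} (cong (ρ k) (sym (repaint-≢ G S′.base c′ S.base (Disjoint.bases D′))))

    merge-≃-collapse : ∀ {H} (m : Merge G H) →
      H ≃ collapse G (Merge.spot m) (ρ (Merge.kind m) (Spot.shade (Merge.spot m)))
    merge-≃-collapse m = merge-unique m (collapse-merge (Merge.spot m) refl) ≃-refl
      refl (sym (Merge.spot-shade m)) (λ _ → refl) refl

    module _ (con : IsConnected G) (3≤ : 3 ≤ size G) where

      private
        member? : ∀ {k n} (s : Spot G k n) w → Dec (Member G con 3≤ s w)
        member? s w = (_≟_ G w (Spot.base s)) ⊎-dec Finₚ.any? λ i → _≟_ G w (Spot.member s i)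

      private
        near-cases : ∀ k {u v} → Near G con 3≤ k u v →
                     (k ≡ sibling × (∀ w → closed G u w ≡ closed G v w)) ⊎ (k ≡ pendant × u ≡ v)
        near-cases sibling near = inj₁ (refl , near)
        near-cases pendant near = inj₂ (refl , near)

      collapse-overlapping : ∀ {k k′} (s : Spot G k (suc (d k))) (s′ : Spot G k′ (suc (d k′))) {w} →
        Member G con 3≤ s w → Member G con 3≤ s′ w →
        collapse G s (ρ k (Spot.shade s)) ≃ collapse G s′ (ρ k′ (Spot.shade s′))
      collapse-overlapping {k} s s′ o o′ with overlapping G con 3≤ s s′ o o′
      ... | refl , shades , near with matching s s′ shades (near-cases k near)
      ...   | φ , members , bases =
        merge-unique (collapse-merge s refl) (collapse-merge s′ refl) φ refl shades members bases

      collapse-diamond : ∀ {k k′} (s : Spot G k (suc (d k))) (s′ : Spot G k′ (suc (d k′))) →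
        let H = collapse G s (ρ k (Spot.shade s)) ; H′ = collapse G s′ (ρ k′ (Spot.shade s′)) in
        H ≃ H′ ⊎ ∃ λ K → Merge H K × Merge H′ K × 2 ≤ size K
      collapse-diamond s s′ with search G (λ w → member? s w ×-dec member? s′ w)
      ... | yes (w , o , o′) = inj₁ (collapse-overlapping s s′ o o′)
      ... | no ¬o = inj₂ (collapse-disjoint s s′ record
        { bases   = λ e → ¬o (_ , inj₁ refl , inj₁ e)
        ; base-   = λ j e → ¬o (_ , inj₁ refl , inj₂ (j , e))
        ; -base   = λ i e → ¬o (_ , inj₂ (i , refl) , inj₁ e)
        ; members = λ i j e → ¬o (_ , inj₂ (i , refl) , inj₂ (j , e)) })

      diamond : ∀ {H H′} → Merge G H → Merge G H′ → H ≃ H′ ⊎ ∃ λ K → Merge H K × Merge H′ K × 2 ≤ size K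
      diamond m m′ = Sum.map
        (λ φ → ≃-trans (merge-≃-collapse m) (≃-trans φ (≃-sym (merge-≃-collapse m′))))
        (λ (K , n , n′ , 2≤) → K , merge-respˡ (≃-sym (merge-≃-collapse m)) n
                           , merge-respˡ (≃-sym (merge-≃-collapse m′)) n′ , 2≤)
        (collapse-diamond (Merge.spot m) (Merge.spot m′))

-- Size, total weight and connectedness under a merge

sum-const : ∀ n x → sum {n} (λ _ → x) ≡ n * x
sum-const zero    x = refl
sum-const (suc n) x = cong (x +_) (sum-const n x)

sum-splitAt : ∀ m {n} (h : Fin m ⊎ Fin n → ℕ) → sum (h ∘ splitAt m) ≡ sum (h ∘ inj₁) + sum (h ∘ inj₂)
sum-splitAt zero    h = refl
sum-splitAt (suc m) h = trans (cong (h (inj₁ zero) +_) (sum-splitAt m (h ∘ Sum.map₁ suc)))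
                              (sym (ℕₚ.+-assoc (h (inj₁ zero)) _ _))

sum-change : ∀ {n} {g h : Fin n → ℕ} i → (∀ j → j ≢ i → g j ≡ h j) → sum g + h i ≡ sum h + g i
sum-change {suc n} {g} {h} zero    eq = trans (cong (λ s → g zero + s + h zero) (sum-cong-≗ λ j → eq (suc j) λ ()))
  (solve 3 (λ a b c → a :+ b :+ c := c :+ b :+ a) refl (g zero) (sum (h ∘ suc)) (h zero))
  where open +-*-Solver
sum-change {suc n} {g} {h} (suc i) eq = trans (ℕₚ.+-assoc (g zero) _ _)
  (trans (cong₂ _+_ (eq zero λ ()) (sum-change i λ j ne → eq (suc j) (ne ∘ Finₚ.suc-injective)))
         (sym (ℕₚ.+-assoc (h zero) _ _)))

module _ {C : Set} where
  open ColouredGraph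

  ≃-permutation : ∀ {G H : ColouredGraph C} → G ≃ H → Permutation (size G) (size H)
  ≃-permutation {G} {H} φ = mk↔ₛ′ (position H ∘ φ.to ∘ vertex G) (position G ∘ φ.from ∘ vertex H)
    (λ i → trans (cong (position H ∘ φ.to) (vertex-position G _))
      (trans (cong (position H) (φ.to-from _)) (position-vertex H i)))
    (λ i → trans (cong (position G ∘ φ.from) (vertex-position H _))
      (trans (cong (position G) (φ.from-to _)) (position-vertex G i)))
    where module φ = _≃_ φ

  size-≃ : ∀ {G H : ColouredGraph C} → G ≃ H → size G ≡ size H
  size-≃ φ = ↔⇒≡ (≃-permutation φ)

  total-≃ : ∀ {G H : ColouredGraph C} f → G ≃ H → total G f ≡ total H f
  total-≃ {G} {H} f φ = sym (trans (sum-permute (λ i → f (colour H (vertex H i))) (≃-permutation φ))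
    (sum-cong-≗ λ i → cong f (trans (cong (colour H) (vertex-position H _)) (_≃_.colours φ (vertex G i)))))

  -- The last summand on each side stands for a subtraction: the expansion exchanges the old colour
  -- of `v` for `c`.
  total-expand : ∀ {k d} {G : ColouredGraph C} {v c} f →
                 total (expand k d G v c) f + f (colour G v) ≡ d * f c + total G f + f c
  total-expand {k} {d} {G} {v} {c} f = begin
    total E f + f (colour G v)
      ≡⟨ cong (_+ f (colour G v)) (trans (sum-cong-≗ λ i → cong (f ∘ colour E) (vertex-expand i))
           (sum-splitAt d (f ∘ colour E ∘ Sum.map₂ (vertex G)))) ⟩
    sum {d} (λ _ → f c) + painted + f (colour G v)
      ≡⟨ cong (λ x → x + painted + f (colour G v)) (sum-const d (f c)) ⟩
    d * f c + painted + f (colour G v)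
      ≡⟨ ℕₚ.+-assoc (d * f c) painted _ ⟩
    d * f c + (painted + f (colour G v))
      ≡⟨ cong (λ x → d * f c + (painted + f (colour G x))) (sym (vertex-position G v)) ⟩
    d * f c + (painted + f (colour G (vertex G (position G v))))
      ≡⟨ cong (d * f c +_) (sum-change (position G v) λ j ne → cong f (repaint-≢ G v c (vertex G j)
           λ e → ne (trans (sym (position-vertex G j)) (cong (position G) (sym e))))) ⟩
    d * f c + (total G f + f (repaint G v c (vertex G (position G v))))
      ≡⟨ cong (λ x → d * f c + (total G f + f x)) (repaint-≡ G v c _ (sym (vertex-position G v))) ⟩
    d * f c + (total G f + f c)
      ≡⟨ sym (ℕₚ.+-assoc (d * f c) _ _) ⟩
    d * f c + total G f + f c ∎
    where
    open ≡-Reasoning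
    E = expand k d G v c
    painted = sum (λ i → f (repaint G v c (vertex G i)))
    vertex-expand : ∀ i → vertex E i ≡ Sum.map₂ (vertex G) (splitAt d i)
    vertex-expand i with splitAt d i
    ... | inj₁ j = refl
    ... | inj₂ j = refl

  uncolour : ColouredGraph C → ColouredGraph ⊤
  uncolour G = record { ColouredGraph G ; colour = λ _ → tt }

  uncolour-≃ : ∀ {G H} → G ≃ H → uncolour G ≃ uncolour H
  uncolour-≃ φ = record { _≃_ φ ; colours = λ _ → refl }

  uncolour-expand : ∀ {k d G v c} → uncolour (expand k d G v c) ≃ expand k d (uncolour G) v tt
  uncolour-expand {k} {d} {G} {v} {c} = record
    { to = id ; from = id ; to-from = λ _ → refl ; from-to = λ _ → refl
    ; edges = λ { (inj₁ i) (inj₁ j) → refl ; (inj₁ i) (inj₂ u) → same k u ; (inj₂ u) (inj₁ i) → same k u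
                ; (inj₂ u) (inj₂ w) → refl }
    ; colours = λ _ → refl }
    where
    same : ∀ k u → link (uncolour G) k v u ≡ link G k v u
    same sibling u = refl
    same pendant u = refl

  module _ {k : Kind} {d : ℕ} {H : ColouredGraph C} {v : V H} {c : C} where

    private
      E = expand k d H v c
      Adj : ∀ (G : ColouredGraph C) → V G → V G → Set
      Adj G u v = edge G u v ≡ true
      flipped : ∀ G u v → Adj G u v → Adj G v u
      flipped G u v e = trans (edge-sym G v u) e
      retract : V E → V H
      retract (inj₁ i) = v
      retract (inj₂ u) = u

    expand-connected : IsConnected H → IsConnected E
    expand-connected (w , path) = inj₂ w , λ x y → out x ◅◅ gmap inj₂ id (path (retract x) (retract y)) ◅◅
      reverse (λ {x} {y} → flipped E x y) (out y)
      where
      out : ∀ x → Star (Adj E) x (inj₂ (retract x))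
      out (inj₁ i) = link-refl H k v ◅ ε
      out (inj₂ u) = ε

    -- Sending the new vertices to `v` maps each edge to an edge or to a single vertex, so walks
    -- project to walks.
    retract-connected : IsConnected E → IsConnected H
    retract-connected (w , path) = retract w , λ x y → walk (path (inj₂ x) (inj₂ y))
      where
      link-walk : ∀ k u → link H k v u ≡ true → Star (Adj H) v u
      link-walk k u e with _≟_ H v u
      link-walk k       u e | yes refl = ε
      link-walk sibling u e | no v≢u   = trans (sym (closed-≢ H v≢u)) e ◅ ε
      link-walk pendant u e | no v≢u   = contradiction (trans (sym e) (==-≢ H v≢u)) λ ()
      step-walk : ∀ x y → Adj E x y → Star (Adj H) (retract x) (retract y)
      step-walk (inj₁ i) (inj₁ j) e = ε
      step-walk (inj₁ i) (inj₂ u) e = link-walk k u e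
      step-walk (inj₂ u) (inj₁ i) e = reverse (λ {x} {y} → flipped H x y) (link-walk k u e)
      step-walk (inj₂ u) (inj₂ w) e = e ◅ ε
      walk : ∀ {x y} → Star (Adj E) x y → Star (Adj H) (retract x) (retract y)
      walk ε       = ε
      walk (_◅_ {x} {y} e p) = step-walk x y e ◅◅ walk p

  connected-≃ : ∀ {G H : ColouredGraph C} → G ≃ H → IsConnected G → IsConnected H
  connected-≃ {G} {H} φ (w , path) = φ.to w , λ x y →
    subst (λ x → Star _ x y) (φ.to-from x) (subst (Star _ _) (φ.to-from y)
      (gmap φ.to (λ {u} {v} e → trans (φ.edges u v) e) (path (φ.from x) (φ.from y))))
    where module φ = _≃_ φ

  module _ {d : Kind → ℕ} {ρ : Kind → C → C} {G H : ColouredGraph C} (m : Merging.Merge d ρ G H) where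
    open Merging d ρ
    open Merge m

    merge-size : size G ≡ suc (d kind) + size H
    merge-size = size-≃ expands

    -- `mult` says that the new colour weighs as much as the `d k + 2` vertices it replaces.
    merge-total : ∀ f → (∀ k c → f (ρ k c) ≡ suc (suc (d k)) * f c) → total G f ≡ total H f
    merge-total f mult = ℕₚ.+-cancelʳ-≡ (f (ρ kind shade)) _ _ (begin
      total G f + f (ρ kind shade)
        ≡⟨ cong₂ _+_ (total-≃ f expands) (cong f (sym recoloured)) ⟩
      total (expand kind (suc (d kind)) H point′ shade) f + f (colour H point′)
        ≡⟨ total-expand {kind} {suc (d kind)} {H} {point′} {shade} f ⟩
      suc (d kind) * f shade + total H f + f shade
        ≡⟨ solve 3 (λ a b c → a :+ b :+ c := b :+ (c :+ a)) refl (suc (d kind) * f shade) (total H f) (f shade) ⟩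
      total H f + suc (suc (d kind)) * f shade
        ≡⟨ cong (total H f +_) (sym (mult kind shade)) ⟩
      total H f + f (ρ kind shade) ∎)
      where
      open ≡-Reasoning
      open +-*-Solver

    merge-connected : IsConnected H → IsConnected G
    merge-connected con = connected-≃ (≃-sym expands) (expand-connected {kind} {suc (d kind)} {H} {point′} {shade} con)

    connected-merge : IsConnected G → IsConnected H
    connected-merge con = retract-connected {kind} {suc (d kind)} {H} {point′} {shade} (connected-≃ expands con)

-- Reduction by single deletions

-- With `d` zero a group has two vertices, so a merge removes one leaf or one of two siblings; a
-- single colour records nothing.
module Deleting = Merging {⊤} (λ _ → 0) (λ _ _ → tt)

Deletion : ColouredGraph ⊤ → ColouredGraph ⊤ → Set
Deletion = Deleting.Merge

module _ where
  open ColouredGraph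

  singleton-≃ : ∀ {G H : ColouredGraph ⊤} → size G ≡ 1 → size H ≡ 1 → G ≃ H
  singleton-≃ {G} {H} g h = record
    { to = λ _ → vertex H (subst Fin (sym h) zero) ; from = λ _ → vertex G (subst Fin (sym g) zero)
    ; to-from = λ _ → unique H h _ _ ; from-to = λ _ → unique G g _ _
    ; edges = λ u v → trans (edge-irrefl H _) (sym (trans (cong (edge G u) (unique G g v u)) (edge-irrefl G u)))
    ; colours = λ _ → refl }
    where
    Fin-unique : ∀ {n} → n ≡ 1 → (i j : Fin n) → i ≡ j
    Fin-unique refl zero zero = refl
    unique : ∀ (G : ColouredGraph ⊤) → size G ≡ 1 → (u v : V G) → u ≡ v
    unique G g u v = position-injective G (Fin-unique g _ _)

  size-pos : ∀ {C} (G : ColouredGraph C) → V G → 1 ≤ size G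
  size-pos G v = Finₚ.injective⇒≤ {f = λ (_ : Fin 1) → position G v} λ { {zero} {zero} _ → refl }

  -- Below three vertices a deletion leads from two vertices to one, and all graphs with one vertex
  -- are isomorphic. So K₂, where the two kinds overlap, does no harm to single deletions.
  deletion-diamond : ∀ {G H H′} → IsConnected G → Deletion G H → Deletion G H′ →
                     H ≃ H′ ⊎ ∃ λ K → Deletion H K × Deletion H′ K
  deletion-diamond {G} {H} {H′} con m m′ with 3 ℕₚ.≤? size G
  ... | yes 3≤ = Sum.map₂ (λ (K , n , n′ , _) → K , n , n′) (Deleting.diamond con 3≤ m m′)
  ... | no 3≰  = inj₁ (singleton-≃ (one m) (one m′))
    where
    one : ∀ {H} → Deletion G H → size H ≡ 1
    one {H} m = ℕₚ.≤-antisym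
      (s≤s⁻¹ (ℕₚ.≤-trans (ℕₚ.≤-reflexive (sym (merge-size m))) (s≤s⁻¹ (ℕₚ.≰⇒> 3≰))))
      (size-pos H (Deleting.Merge.point′ m))

module Reduction = Rewriting ≃-equiv (ColouredGraph.IsConnected {⊤}) Deletion
  Deleting.merge-respˡ (λ con m → connected-merge m con) deletion-diamond
open Reduction using () renaming (_▷*_ to _⇒*_; Normal to Irreducible)

module _ where
  open ColouredGraph

  ⇒*-connected : ∀ {G H} → G ⇒* H → IsConnected H → IsConnected G
  ⇒*-connected (Reduction.done e)   con = connected-≃ (≃-sym e) con
  ⇒*-connected (Reduction.step m r) con = merge-connected m (⇒*-connected r con)

  expand-zero : ∀ {k} {G : ColouredGraph ⊤} {v} → expand k 0 G v tt ≃ G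
  expand-zero = record
    { to = λ { (inj₁ ()) ; (inj₂ u) → u } ; from = inj₂ ; to-from = λ _ → refl
    ; from-to = λ { (inj₁ ()) ; (inj₂ u) → refl }
    ; edges = λ { (inj₁ ()) _ ; (inj₂ u) (inj₁ ()) ; (inj₂ u) (inj₂ w) → refl } ; colours = λ _ → refl }

  expand-suc : ∀ {k d} {G : ColouredGraph ⊤} {v} →
               expand k (suc d) G v tt ≃ expand k 1 (expand k d G v tt) (inj₂ v) tt
  expand-suc {k} {d} {G} {v} = record
    { to = to ; from = from
    ; to-from = λ { (inj₁ zero) → refl ; (inj₂ (inj₁ i)) → refl ; (inj₂ (inj₂ u)) → refl }
    ; from-to = λ { (inj₁ zero) → refl ; (inj₁ (suc i)) → refl ; (inj₂ u) → refl }
    ; edges = λ where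
        (inj₁ zero)    (inj₁ zero)    → refl
        (inj₁ zero)    (inj₁ (suc j)) → trans (link-new k d G v tt j) (sym (Boolₚ.∧-identityʳ _))
        (inj₁ zero)    (inj₂ u)       → expand-link {k = k} {d} G {v} {tt} k v u
        (inj₁ (suc i)) (inj₁ zero)    → trans (link-new k d G v tt i) (sym (Boolₚ.∧-identityʳ _))
        (inj₁ (suc i)) (inj₁ (suc j)) → refl
        (inj₁ (suc i)) (inj₂ u)       → refl
        (inj₂ u)       (inj₁ zero)    → expand-link {k = k} {d} G {v} {tt} k v u
        (inj₂ u)       (inj₁ (suc j)) → refl
        (inj₂ u)       (inj₂ w)       → refl
    ; colours = colours }
    where
    to : Fin (suc d) ⊎ V G → Fin 1 ⊎ (Fin d ⊎ V G)
    to (inj₁ zero)    = inj₁ zero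
    to (inj₁ (suc i)) = inj₂ (inj₁ i)
    to (inj₂ u)       = inj₂ (inj₂ u)
    from : Fin 1 ⊎ (Fin d ⊎ V G) → Fin (suc d) ⊎ V G
    from (inj₁ zero)     = inj₁ zero
    from (inj₂ (inj₁ i)) = inj₁ (suc i)
    from (inj₂ (inj₂ u)) = inj₂ u
    colours : ∀ (u : Fin (suc d) ⊎ V G) → tt ≡ tt
    colours _ = refl

  -- The new vertices can be removed one by one, since each stays attached to `v`. Hence a merge,
  -- once colours are forgotten, is a sequence of single deletions.
  expand-⇒* : ∀ k d {G v} → expand k d G v tt ⇒* G
  expand-⇒* k zero    = Reduction.done expand-zero
  expand-⇒* k (suc d) = Reduction.step
    (Deleting.merge-respˡ (≃-sym expand-suc) (Deleting.expand-merge refl)) (expand-⇒* k d)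

  module _ {C : Set} {d : Kind → ℕ} {ρ : Kind → C → C} {G H : ColouredGraph C} (m : Merging.Merge d ρ G H) where

    merge-⇒* : uncolour G ⇒* uncolour H
    merge-⇒* = Reduction.▷*-resp (≃-sym (≃-trans (uncolour-≃ (Merging.Merge.expands m))
      (uncolour-expand {k = k} {suc (d k)} {H} {Merging.Merge.point′ m} {Merging.Merge.shade m}))) (expand-⇒* k (suc (d k)))
      where k = Merging.Merge.kind m

  strips : ∀ {G H N} → IsConnected G → Irreducible N → G ⇒* H → G ⇒* N → H ⇒* N
  strips con irr (Reduction.done e)   r = Reduction.▷*-resp e r
  strips con irr (Reduction.step m s) r = strips (connected-merge m con) irr s (Reduction.strip con irr m r)

-- Cancellation

recolour : ∀ {C D : Set} → (C → D) → ColouredGraph C → ColouredGraph D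
recolour f G = record { ColouredGraph G ; colour = f ∘ ColouredGraph.colour G }

module _ {C D : Set} {f : C → D} {G : ColouredGraph C} where
  open ColouredGraph

  recolour-link : ∀ k u v → link (recolour f G) k u v ≡ link G k u v
  recolour-link sibling u v = refl
  recolour-link pendant u v = refl

  unrecolour-spot : ∀ {k n} (s : Spot (recolour f G) k n) →
    (∀ i → colour G (Spot.member s i) ≡ colour G (Spot.base s)) → Spot G k n
  unrecolour-spot {k} s same = record
    { member = Spot.member s ; injective = Spot.injective s ; base = Spot.base s
    ; attached = λ i → Spot.≢base s i , λ w ne → trans (proj₂ (Spot.attached s i) w ne) (recolour-link k _ w)
    ; same = same }

-- Finite lists of coloured graphs up to isomorphism

fromGraph : ∀ {C n} → Graph n → (Fin n → C) → ColouredGraph C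
fromGraph {n = n} G colours = record
  { V = Fin n ; size = n ; enum = mk↔ₛ′ id id (λ _ → refl) (λ _ → refl)
  ; edge = adj G ; edge-sym = adj-sym G ; edge-irrefl = adj-irrefl G ; colour = colours }

module _ {C : Set} where
  open ColouredGraph

  toGraph : (G : ColouredGraph C) → Graph (size G)
  toGraph G = record
    { adj = λ i j → edge G (vertex G i) (vertex G j)
    ; adj-sym = λ i j → edge-sym G _ _ ; adj-irrefl = λ i → edge-irrefl G _ }

  ≃-fromGraph : ∀ (G : ColouredGraph C) {n} {H : Graph n} (φ : toGraph G ≅ H) {colours : Fin n → C} →
    (∀ j → colour G (vertex G (_≅_.bijection φ ⟨$⟩ˡ j)) ≡ colours j) → G ≃ fromGraph H colours
  ≃-fromGraph G {H = H} φ {colours} eq = record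
    { to = λ u → π ⟨$⟩ʳ position G u ; from = λ j → vertex G (π ⟨$⟩ˡ j)
    ; to-from = λ j → trans (cong (π ⟨$⟩ʳ_) (position-vertex G _)) (Perm.inverseʳ π)
    ; from-to = λ u → trans (cong (vertex G) (Perm.inverseˡ π)) (vertex-position G u)
    ; edges = λ u v → trans (_≅_.preserves φ _ _) (cong₂ (edge G) (vertex-position G u) (vertex-position G v))
    ; colours = λ u → trans (sym (eq _)) (cong (colour G) (trans (cong (vertex G) (Perm.inverseˡ π)) (vertex-position G u))) }
    where π = _≅_.bijection φ

  colourings : List C → ∀ n → List (Fin n → C)
  colourings palette n = List.map (λ a → lookup palette ∘ fun n (List.length palette) a)
                                  (allFin (List.length palette ^ n))

  colourings-complete : ∀ palette {n} (f : Fin n → C) → (∀ i → f i ∈ palette) →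
                        Any (λ g → ∀ i → f i ≡ g i) (colourings palette n)
  colourings-complete palette {n} f f∈ = Anyₚ.map⁺ (lose (∈-allFin (code n (List.length palette) (index ∘ f∈)))
    λ i → trans (lookup-index (f∈ i)) (cong (lookup palette) (sym (fun-code n (List.length palette) (index ∘ f∈) i))))

  graphs : List C → ℕ → List (ColouredGraph C)
  graphs palette n = List.concatMap (λ H → List.map (fromGraph H) (colourings palette n)) (allGraphs n)

  graphs-complete : ∀ palette (G : ColouredGraph C) → (∀ v → colour G v ∈ palette) →
                    Any (G ≃_) (graphs palette (size G))
  graphs-complete palette G G∈ = Anyₚ.concatMap⁺ (λ H → List.map (fromGraph H) (colourings palette (size G)))
    (Any.map (λ φ → Anyₚ.map⁺ (Any.map (≃-fromGraph G φ)
      (colourings-complete palette (λ j → colour G (vertex G (_≅_.bijection φ ⟨$⟩ˡ j))) λ j → G∈ _)))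
      (allGraphs-complete (toGraph G)))

  candidates : List C → ℕ → List (ColouredGraph C)
  candidates palette k = List.concatMap (graphs palette) (List.upTo (suc k))

  candidates-complete : ∀ palette k (G : ColouredGraph C) → (∀ v → colour G v ∈ palette) → size G ≤ k →
                        Any (G ≃_) (candidates palette k)
  candidates-complete palette k G G∈ G≤ =
    Anyₚ.concatMap⁺ (graphs palette) (lose (∈-upTo⁺ (s≤s G≤)) (graphs-complete palette G G∈))

≤-sum : ∀ {n} (f : Fin n → ℕ) i → f i ≤ sum f
≤-sum f zero    = ℕₚ.m≤m+n _ _
≤-sum f (suc i) = ℕₚ.≤-trans (≤-sum (f ∘ suc) i) (ℕₚ.m≤n+m _ (f zero))

sum-≥ : ∀ {n} (f : Fin n → ℕ) → (∀ i → 1 ≤ f i) → n ≤ sum f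
sum-≥ {zero}  f f≥1 = z≤n
sum-≥ {suc n} f f≥1 = ℕₚ.+-mono-≤ (f≥1 zero) (sum-≥ (f ∘ suc) (f≥1 ∘ suc))

sum-tight : ∀ {n} (f : Fin n → ℕ) → (∀ i → 1 ≤ f i) → sum f ≤ n → ∀ i → f i ≤ 1
sum-tight {suc n} f f≥1 f≤ zero    = ℕₚ.+-cancelʳ-≤ n _ _ (ℕₚ.≤-trans (ℕₚ.+-monoʳ-≤ (f zero) (sum-≥ (f ∘ suc) (f≥1 ∘ suc))) f≤)
sum-tight {suc n} f f≥1 f≤ (suc i) = sum-tight (f ∘ suc) (f≥1 ∘ suc)
  (s≤s⁻¹ (ℕₚ.≤-trans (ℕₚ.+-monoˡ-≤ _ (f≥1 zero)) f≤)) i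

-- Words of merges, their weights and the induction

Word : Set
Word = List Kind

words : ℕ → List Word
words zero    = [] ∷ []
words (suc n) = [] ∷ List.map (sibling ∷_) (words n) List.++ List.map (pendant ∷_) (words n)

words-complete : ∀ n w → List.length w ≤ n → w ∈ words n
words-complete zero    []            _ = here refl
words-complete (suc n) []            _ = here refl
words-complete (suc n) (sibling ∷ w) (s≤s l) = there (∈-++⁺ˡ (∈-map⁺ _ (words-complete n w l)))
words-complete (suc n) (pendant ∷ w) (s≤s l) =
  there (∈-++⁺ʳ (List.map (sibling ∷_) (words n)) (∈-map⁺ _ (words-complete n w l)))

module Cancellation (d : Kind → ℕ) {R : ColouredGraph ⊤}
  (R-connected : ColouredGraph.IsConnected R) (R-irreducible : Irreducible R) where
  open ColouredGraph

  ReducesToR : ∀ {C} → ColouredGraph C → Set₁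
  ReducesToR G = uncolour G ⇒* R

  -- The number of vertices that a vertex carrying the word w stands for.
  weight : Word → ℕ
  weight []      = 1
  weight (k ∷ w) = suc (suc (d k)) * weight w

  weight-≥1 : ∀ w → 1 ≤ weight w
  weight-≥1 []      = ℕₚ.≤-refl
  weight-≥1 (k ∷ w) = ℕₚ.≤-trans (weight-≥1 w) (ℕₚ.m≤m+n _ _)

  -- Every letter at least doubles the weight. So a bound on the weight leaves finitely many words,
  -- and finiteness passes to the extended colours.
  length<weight : ∀ w → List.length w < weight w
  length<weight []      = ℕₚ.≤-refl
  length<weight (k ∷ w) = ℕₚ.≤-trans (ℕₚ.+-mono-≤ (weight-≥1 w) (length<weight w))
    (ℕₚ.+-monoʳ-≤ (weight w) (ℕₚ.m≤m+n _ _))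

  weight-trivial : ∀ w → weight w ≤ 1 → w ≡ []
  weight-trivial []      _ = refl
  weight-trivial (k ∷ w) l = contradiction (ℕₚ.≤-trans (length<weight (k ∷ w)) l) λ { (s≤s ()) }

  module _ {I C : Set} (ω : I → C → ℕ) (t : I → ℕ) where

    -- A whole family of totals is prescribed because each extension of the colours by words brings
    -- a further weight that merging preserves.
    Class : ColouredGraph C → Set₁
    Class G = ReducesToR G × (∀ i → total G (ω i) ≡ t i)

    -- A colour with ω i c > t i for some i cannot occur on a graph of the class.
    Finite : Set
    Finite = ∃ λ palette → ∀ c → (∀ i → ω i c ≤ t i) → c ∈ palette

  module _ {C : Set} (τ : Kind → Kind) where

    -- K₂ counts as sparse: its two vertices are leaves and siblings at once, so
    -- there the two kinds of merge would overlap.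
    Sparse : ColouredGraph C → Set
    Sparse G = 3 ≤ size G → ∀ k → ¬ Spot G k (suc (d (τ k)))

    Sparse-≃ : ∀ {G H} → G ≃ H → Sparse G → Sparse H
    Sparse-≃ φ sp 3≤ k s = sp (subst (3 ≤_) (sym (size-≃ φ)) 3≤) k (to-spot (≃-sym φ) s)

  module _ {I C : Set} (ω : I → C → ℕ) (t : I → ℕ) where

    Class-≃ : ∀ {G H} → G ≃ H → Class ω t G → Class ω t H
    Class-≃ φ (r , totals) = Reduction.▷*-resp (uncolour-≃ φ) r , λ i → trans (sym (total-≃ (ω i) φ)) (totals i)

    class-connected : ∀ {G} → Class ω t G → IsConnected G
    class-connected (r , _) = ⇒*-connected r R-connected

    class-size-exists : Finite ω t → (P : ColouredGraph C → Set₁) → (∀ {G H} → G ≃ H → P G → P H) → ∀ k →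
      (∀ {G} → P G → Class ω t G × size G ≤ k) → ¬ ¬ ∃ (Size _≃_ P)
    class-size-exists (palette , complete) P P-≃ k P⇒ = size-exists ≃-equiv P-≃ (lookup (candidates palette k)) λ G p →
      let (_ , totals) , G≤ = P⇒ p
          G∈ = candidates-complete palette k G (λ v → complete _ λ i → subst (ω i (colour G v) ≤_) (totals i)
                 (subst (λ u → ω i (colour G u) ≤ total G (ω i)) (vertex-position G v)
                   (≤-sum (λ j → ω i (colour G (vertex G j))) (position G v)))) G≤
      in index G∈ , lookup-index G∈


  module System {I C : Set} (ω : I → C → ℕ) (t : I → ℕ) (k : ℕ) where

    Coloured : Set₁
    Coloured = ColouredGraph (C × Word)

    -- A vertex with word `w` stands for `weight w` vertices of colour `c`. The index `nothing`
    -- counts these vertices themselves, and the old weights are scaled accordingly, so every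
    -- component is preserved by merges.
    ω′ : Maybe I → C × Word → ℕ
    ω′ nothing  (_ , w) = weight w
    ω′ (just i) (c , w) = weight w * ω i c

    t′ : Maybe I → ℕ
    t′ nothing  = suc k
    t′ (just i) = t i

    Class′ : Coloured → Set₁
    Class′ = Class ω′ t′

    finite′ : Finite ω t → Finite ω′ t′
    finite′ (palette , complete) = List.cartesianProduct palette (words (suc k)) , λ (c , w) bound →
      ∈-cartesianProduct⁺
        (complete c λ i → ℕₚ.≤-trans (ℕₚ.≤-trans (ℕₚ.≤-reflexive (sym (ℕₚ.*-identityˡ _)))
          (ℕₚ.*-monoˡ-≤ (ω i c) (weight-≥1 w))) (bound (just i)))
        (words-complete (suc k) w (ℕₚ.≤-trans (ℕₚ.<⇒≤ (length<weight w)) (bound nothing)))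

    class′-size : ∀ {G} → Class′ G → size G ≤ suc k
    class′-size {G} (_ , totals) = subst (size G ≤_) (totals nothing)
      (sum-≥ (λ i → weight (proj₂ (colour G (vertex G i)))) λ i → weight-≥1 (proj₂ (colour G (vertex G i))))

    -- The weights are at least 1 and add up to `suc k`; with `suc k` vertices none can exceed 1.
    trivial-words : ∀ {G} → Class′ G → suc k ≤ size G → ∀ v → proj₂ (colour G v) ≡ []
    trivial-words {G} (_ , totals) k< v = weight-trivial _ (subst (λ u → weight (proj₂ (colour G u)) ≤ 1) (vertex-position G v)
      (sum-tight (λ i → weight (proj₂ (colour G (vertex G i)))) (λ i → weight-≥1 (proj₂ (colour G (vertex G i))))
        (subst (_≤ size G) (sym (totals nothing)) k<) (position G v)))

    module _ (τ : Kind → Kind) where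

      -- The letter is `τ κ` and not `κ`: it names the bound that fixed the size of the group. The
      -- weight of a letter is therefore the same for every `τ`.
      extend : Kind → C × Word → C × Word
      extend κ (c , w) = c , τ κ ∷ w

      open Merging (d ∘ τ) extend

      infix 4 _▷_
      _▷_ : Coloured → Coloured → Set
      G ▷ H = 3 ≤ size G × Merge G H

      ω′-extend : ∀ i κ c → ω′ i (extend κ c) ≡ suc (suc (d (τ κ))) * ω′ i c
      ω′-extend nothing  κ c = refl
      ω′-extend (just i) κ (c , w) = ℕₚ.*-assoc (suc (suc (d (τ κ)))) (weight w) (ω i c)

      merge-class : ∀ {G H} → Class′ G → G ▷ H → Class′ H
      merge-class {G} c@(r , totals) (_ , m) = strips (class-connected ω′ t′ {G} c) R-irreducible (merge-⇒* m) r
        , λ i → trans (sym (merge-total m (ω′ i) (ω′-extend i))) (totals i)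

      class-merge : ∀ {G H} → Class′ H → G ▷ H → Class′ G
      class-merge (r , totals) (_ , m) = Reduction.▷*-trans (merge-⇒* m) r
        , λ i → trans (merge-total m (ω′ i) (ω′-extend i)) (totals i)

      ▷-< : ∀ {G H} → G ▷ H → size H < size G
      ▷-< {G} {H} (_ , m) = ℕₚ.≤-trans (s≤s (ℕₚ.m≤n+m (size H) _)) (ℕₚ.≤-reflexive (sym (merge-size m)))

      ▷-diamond : ∀ {G H H′} → Class′ G → G ▷ H → G ▷ H′ → H ≃ H′ ⊎ ∃ λ K → (H ▷ K) × (H′ ▷ K)
      ▷-diamond {G} c (3≤ , m) (_ , m′) = Sum.map₂ (λ (K , n , n′ , 2≤) → K , (large n 2≤ , n) , (large n′ 2≤ , n′))
        (diamond (class-connected ω′ t′ {G} c) 3≤ m m′)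
        where
        large : ∀ {H K} → Merge H K → 2 ≤ size K → 3 ≤ size H
        large n 2≤ = ℕₚ.≤-trans (s≤s (ℕₚ.≤-trans 2≤ (ℕₚ.m≤n+m _ _))) (ℕₚ.≤-reflexive (sym (merge-size n)))

      module _ (τ-injective : ∀ {κ κ′} → τ κ ≡ τ κ′ → κ ≡ κ′) where

        ▷-codiamond : ∀ {G H H′} → Class′ G → H ▷ G → H′ ▷ G → H ≃ H′ ⊎ ∃ λ K → (K ▷ H) × (K ▷ H′)
        ▷-codiamond _ (3≤ , m) (_ , m′) = Sum.map₂ (λ (K , n , n′) → K , (large n , n) , (large n , n′))
          (codiamond (λ e → τ-injective (Listₚ.∷-injectiveˡ (cong proj₂ e))
                          , cong₂ _,_ (cong proj₁ e) (Listₚ.∷-injectiveʳ (cong proj₂ e))) m m′)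
          where
          large : ∀ {K} → Merge K _ → 3 ≤ size K
          large n = ℕₚ.≤-trans 3≤ (ℕₚ.≤-trans (ℕₚ.m≤n+m _ _) (ℕₚ.≤-reflexive (sym (merge-size n))))

        Conormal : Coloured → Set₁
        Conormal G = ∀ H → ¬ (H ▷ G)

        size-sparse-conormal : ∀ {m n} → Size _≃_ (λ G → Class′ G × Sparse τ G) m →
                               Size _≃_ (λ G → Class′ G × Conormal G) n → m ≡ n
        size-sparse-conormal S = size-normal-conormal ≃-equiv Class′ (Class-≃ ω′ t′) _▷_
          (λ φ (3≤ , m) → subst (3 ≤_) (size-≃ φ) 3≤ , merge-respˡ φ m)
          (λ φ (3≤ , m) → 3≤ , merge-respʳ φ m)
          merge-class class-merge ▷-diamond ▷-codiamond
          -- Merging lowers the number of vertices; expanding lowers the distance to `suc k`, an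
          -- upper bound for the whole class.
          size (λ G → suc k ∸ size G)
          (λ _ → ▷-<) (λ {G} p s → ℕₚ.∸-monoʳ-< (▷-< s) (class′-size {G} (class-merge p s)))
          (size-map ≃-equiv
            (λ (p , sp) → p , λ { H (3≤ , m) → sp 3≤ _ (Merge.spot m) })
            (λ { (p , nf) → p , λ 3≤ κ s → nf _ (3≤ , collapse-merge s refl) }) S)

    -- An expansion reads only the first letter of a word, which fixes the number of new vertices.
    -- Under either assignment some kind writes that letter, and the expanded graph has the same
    -- size, so the condition of three vertices carries over.
    conormal-independent : ∀ τ τ′ → (∀ κ → τ (τ κ) ≡ κ) → ∀ {G} → (∀ H → ¬ (_▷_ τ H G)) → ∀ H → ¬ (_▷_ τ′ H G)
    conormal-independent τ τ′ τ-involutive {G} nf H (3≤ , m) = nf (expand κ (suc (d (τ κ))) G point′ shade)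
      (subst (3 ≤_) (trans (merge-size m) (cong (λ x → suc (d x) + size G) (sym same))) 3≤
      , Merging.expand-merge (d ∘ τ) (extend τ) (trans recoloured (cong (λ x → proj₁ shade , x ∷ proj₂ shade) (sym same))))
      where
      open Merging.Merge m
      κ = τ (τ′ kind)
      same : τ κ ≡ τ′ kind
      same = τ-involutive (τ′ kind)

    -- Conormal graphs do not depend on which kind of group has which size.
    size-sparse-independent : ∀ τ τ′ → (∀ κ → τ (τ κ) ≡ κ) → (∀ κ → τ′ (τ′ κ) ≡ κ) → Finite ω t → ∀ {m n} →
      Size _≃_ (λ G → Class′ G × Sparse τ G) m → Size _≃_ (λ G → Class′ G × Sparse τ′ G) n → m ≡ n
    size-sparse-independent τ τ′ inv inv′ finite S T = ≡-stable (
      class-size-exists ω′ t′ (finite′ finite) (λ G → Class′ G × Conormal τ (injective inv) G)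
        (λ φ (c , nf) → Class-≃ ω′ t′ φ c , λ H (3≤ , m) → nf H (3≤ , Merging.merge-respʳ (d ∘ τ) (extend τ) (≃-sym φ) m))
        (suc k) (λ {G} (c , _) → c , class′-size {G} c)
      >>= λ (r , U) → return (trans (size-sparse-conormal τ (injective inv) S U)
        (sym (size-sparse-conormal τ′ (injective inv′) T (size-map ≃-equiv
          (λ (c , nf) → c , conormal-independent τ τ′ inv nf)
          (λ (c , nf) → c , conormal-independent τ′ τ inv′ nf) U)))))
      where
      injective : ∀ {τ : Kind → Kind} → (∀ κ → τ (τ κ) ≡ κ) → ∀ {κ κ′} → τ κ ≡ τ κ′ → κ ≡ κ′
      injective {τ} inv {κ} {κ′} e = trans (sym (inv κ)) (trans (cong τ e) (inv κ′))

    module _ (τ : Kind → Kind) where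

      -- Total weight `suc k` on more than `k` vertices makes all words empty, so these are the
      -- `Plain` graphs with an empty word added. The negated bound is the form in which
      -- `size-split` delivers the complement.
      Blank : Coloured → Set₁
      Blank G = (Class′ G × Sparse τ G) × ¬ size G ≤ k

      Plain : ColouredGraph C → Set₁
      Plain G = ((Class ω t G × Sparse τ G) × size G ≤ suc k) × ¬ size G ≤ k

      private
        blank : ColouredGraph C → Coloured
        blank = recolour λ c → c , []

        blank-cong : ∀ {G H} → G ≃ H → blank G ≃ blank H
        blank-cong φ = record { _≃_ φ ; colours = λ u → cong (_, []) (_≃_.colours φ u) }

        unblank : ∀ {G H} → blank G ≃ blank H → G ≃ H
        unblank φ = record { _≃_ φ ; colours = λ u → cong proj₁ (_≃_.colours φ u) }

        plain-blank : ∀ G → Plain G → ∃ λ H → Blank H × blank G ≃ H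
        plain-blank G (((( r , totals) , sp) , ≤k+1) , ≰k) = blank G
          , (((r , λ { nothing → trans (sum-const (size G) 1) (trans (ℕₚ.*-identityʳ _) (ℕₚ.≤-antisym ≤k+1 (ℕₚ.≰⇒> ≰k)))
                     ; (just i) → trans (sum-cong-≗ {size G} λ _ → ℕₚ.*-identityˡ _) (totals i) })
             , λ 3≤ κ s → sp 3≤ κ (unrecolour-spot {f = _, []} s λ i → cong proj₁ (Spot.same s i))) , ≰k) , ≃-refl

        blank-plain : ∀ G → Blank G → ∃ λ H → Plain H × blank H ≃ G
        blank-plain G ((c@(r , totals) , sp) , ≰k) = H
          , ((((r , λ i → trans (sum-cong-≗ {size G} λ j → trans (sym (ℕₚ.*-identityˡ _))
                 (cong (λ w → weight w * ω i (colour H (vertex H j))) (sym (empty (vertex H j))))) (totals (just i)))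
              , λ 3≤ κ s → sp 3≤ κ (unrecolour-spot {f = proj₁} s λ j → cong₂ _,_ (Spot.same s j)
                  (trans (empty _) (sym (empty _)))))
             , class′-size {G} c) , ≰k)
          , record { to = id ; from = id ; to-from = λ _ → refl ; from-to = λ _ → refl ; edges = λ _ _ → refl
                   ; colours = λ u → cong (proj₁ (colour G u) ,_) (empty u) }
          where
          H = recolour proj₁ G
          empty : ∀ v → proj₂ (colour G v) ≡ []
          empty = trivial-words {G} c (ℕₚ.≰⇒> ≰k)

      size-blank : ∀ {m n} → Size _≃_ Plain m → Size _≃_ Blank n → m ≡ n
      size-blank S T = ℕₚ.≤-antisym
        (size-≤ ≃-equiv ≃-equiv (λ G H → blank G ≃ H) (λ G p → return (plain-blank G p))
          (λ _ _ φ φ′ e → unblank (≃-trans φ (≃-trans e (≃-sym φ′)))) S T)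
        (size-≤ ≃-equiv ≃-equiv (λ G H → blank H ≃ G) (λ G p → return (blank-plain G p))
          (λ _ _ φ φ′ e → ≃-trans (≃-sym φ) (≃-trans (blank-cong e) φ′)) T S)

  Bounded : ∀ {I C} (ω : I → C → ℕ) (t : I → ℕ) (τ : Kind → Kind) (k : ℕ) → ColouredGraph C → Set₁
  Bounded ω t τ k G = (Class ω t G × Sparse τ G) × size G ≤ k

  Bounded-≃ : ∀ {I C} (ω : I → C → ℕ) (t : I → ℕ) τ k {G H} → G ≃ H → Bounded ω t τ k G → Bounded ω t τ k H
  Bounded-≃ ω t τ k φ ((c , sp) , ≤k) = (Class-≃ ω t φ c , Sparse-≃ τ φ sp) , subst (_≤ k) (size-≃ φ) ≤k

  -- The number in question is `a + p`, with `a` counting the graphs on at most `k` vertices and `p`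
  -- those on `suc k`. Over the extended colours, `b + p` is independent of the assignment by
  -- merging. The hypothesis for `k` settles `b` over the extended colours, which isolates `p`, and
  -- settles `a` over the old ones.
  size-bounded-independent : ∀ τ τ′ → (∀ κ → τ (τ κ) ≡ κ) → (∀ κ → τ′ (τ′ κ) ≡ κ) → ∀ k {I C : Set}
    (ω : I → C → ℕ) (t : I → ℕ) → Finite ω t → ∀ {m n} →
    Size _≃_ (Bounded ω t τ k) m → Size _≃_ (Bounded ω t τ′ k) n → m ≡ n
  size-bounded-independent τ τ′ inv inv′ zero ω t finite S T = size-unique ≃-equiv small small S T
    where
    small : ∀ {τ τ′ G} → Bounded ω t τ 0 G → Bounded ω t τ′ 0 G
    small ((c , _) , ≤0) = (c , λ 3≤ _ _ → contradiction (ℕₚ.≤-trans 3≤ ≤0) λ ()) , ≤0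
  size-bounded-independent τ τ′ inv inv′ (suc k) ω t finite S T = ≡-stable (
    parts τ S >>= λ (a , b , p , A , B , P , m≡) →
    parts τ′ T >>= λ (a′ , b′ , p′ , A′ , B′ , P′ , n≡) →
    return (trans m≡ (trans (cong₂ _+_
      (size-bounded-independent τ τ′ inv inv′ k ω t finite A A′)
      (ℕₚ.+-cancelˡ-≡ b _ _ (trans (size-sparse-independent τ τ′ inv inv′ finite P P′)
        (cong (_+ p′) (sym (size-bounded-independent τ τ′ inv inv′ k ω′ t′ (finite′ finite) B B′))))))
      (sym n≡))))
    where
    open System ω t k
    ≤k-≃ : ∀ {C} {G H : ColouredGraph C} → G ≃ H → size G ≤ k → size H ≤ k
    ≤k-≃ φ = subst (_≤ k) (size-≃ φ)
    parts : ∀ τ {m} → Size _≃_ (Bounded ω t τ (suc k)) m → ¬ ¬ ∃ λ a → ∃ λ b → ∃ λ p →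
      Size _≃_ (Bounded ω t τ k) a × Size _≃_ (Bounded ω′ t′ τ k) b ×
      Size _≃_ (λ G → Class′ G × Sparse τ G) (b + p) × m ≡ a + p
    parts τ S =
      class-size-exists ω t finite (Bounded ω t τ k) (Bounded-≃ ω t τ k) k (λ ((c , _) , ≤k) → c , ≤k) >>= λ (a , A) →
      class-size-exists ω t finite (Plain τ)
        (λ φ (b , ≰k) → Bounded-≃ ω t τ (suc k) φ b , ≰k ∘ ≤k-≃ (≃-sym φ)) (suc k)
        (λ (((c , _) , ≤k) , _) → c , ≤k) >>= λ (q , Q) →
      class-size-exists ω′ t′ (finite′ finite) (Bounded ω′ t′ τ k) (Bounded-≃ ω′ t′ τ k) k
        (λ ((c , _) , ≤k) → c , ≤k) >>= λ (b , B) →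
      class-size-exists ω′ t′ (finite′ finite) (Blank τ)
        (λ φ ((c , sp) , ≰k) → (Class-≃ ω′ t′ φ c , Sparse-≃ τ φ sp) , ≰k ∘ ≤k-≃ (≃-sym φ)) (suc k)
        (λ {G} ((c , _) , _) → c , class′-size {G} c) >>= λ (p , P) →
      return (a , b , p , A , B , size-split ≃-equiv ≤k-≃ B P ,
        trans (size-unique ≃-equiv id id S (size-split ≃-equiv ≤k-≃
          (size-map ≃-equiv (λ (cs , ≤k) → (cs , ℕₚ.m≤n⇒m≤1+n ≤k) , ≤k) (λ ((cs , _) , ≤k) → cs , ≤k) A) Q))
          (cong (a +_) (size-blank τ Q P)))

-- Comparison with the reduction process

size-one : ∀ {n} (f : Fin n → Bool) → ∣ Vec.tabulate f ∣ ≡ 1 → ∃ λ y → ∀ w → f w ≡ does (y Finₚ.≟ w)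
size-one {suc n} f e with f zero in f0
... | true  = zero , λ { zero → f0 ; (suc w) → empty (f ∘ suc) (ℕₚ.suc-injective e) w }
  where
  empty : ∀ {n} (f : Fin n → Bool) → ∣ Vec.tabulate f ∣ ≡ 0 → ∀ w → f w ≡ false
  empty {suc n} f e w       with f zero in f0
  empty {suc n} f () w      | true
  empty {suc n} f e zero    | false = f0
  empty {suc n} f e (suc w) | false = empty (f ∘ suc) e w
... | false = let y , eq = size-one (f ∘ suc) e in suc y , λ { zero → f0 ; (suc w) → eq w }

one-size : ∀ {n} (f : Fin n → Bool) y → (∀ w → f w ≡ does (y Finₚ.≟ w)) → ∣ Vec.tabulate f ∣ ≡ 1
one-size {suc n} f zero    eq rewrite eq zero = cong suc (empty (f ∘ suc) (eq ∘ suc))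
  where
  empty : ∀ {n} (f : Fin n → Bool) → (∀ w → f w ≡ false) → ∣ Vec.tabulate f ∣ ≡ 0
  empty {zero}  f eq = refl
  empty {suc n} f eq rewrite eq zero = empty (f ∘ suc) (eq ∘ suc)
one-size {suc n} f (suc y) eq rewrite eq zero = one-size (f ∘ suc) y (eq ∘ suc)

lookup-⁅⁆ : ∀ {n} (x w : Fin n) → Vec.lookup ⁅ x ⁆ w ≡ does (x Finₚ.≟ w)
lookup-⁅⁆ zero    zero    = refl
lookup-⁅⁆ zero    (suc w) = Vecₚ.lookup-replicate w false
lookup-⁅⁆ (suc x) zero    = refl
lookup-⁅⁆ (suc x) (suc w) = lookup-⁅⁆ x w

least : ∀ {n} {Q : Fin n → Set} → Decidable Q → ∃ Q → ∃ λ i → Q i × (∀ j → Q j → i Fin.≤ j)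
least {suc n} {Q} Q? (x , q) with Q? zero
... | yes q₀ = zero , q₀ , λ _ _ → z≤n
... | no ¬q₀ = let i , qi , min = least (Q? ∘ suc) (later x q) in
  suc i , qi , λ { zero q → contradiction q ¬q₀ ; (suc j) q → s≤s (min j q) }
  where
  later : ∀ x → Q x → ∃ (Q ∘ suc)
  later zero    q = contradiction q ¬q₀
  later (suc x) q = x , q

plain : ∀ {n} → Graph n → ColouredGraph ⊤
plain G = fromGraph G λ _ → tt

module _ {n : ℕ} (G : Graph n) where
  open ColouredGraph (plain G)

  lookup-N : ∀ u w → Vec.lookup (N[_] G u) w ≡ closed u w
  lookup-N u w = trans (Vecₚ.lookup-zipWith _∨_ w ⁅ u ⁆ _)
    (cong₂ _∨_ (lookup-⁅⁆ u w) (Vecₚ.lookup∘tabulate (adj G u) w))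

  sameN⇒closed : ∀ {u v} → N[_] G u ≡ N[_] G v → ∀ w → closed u w ≡ closed v w
  sameN⇒closed e w = trans (sym (lookup-N _ w)) (trans (cong (λ N → Vec.lookup N w) e) (lookup-N _ w))

  closed⇒sameN : ∀ {u v} → (∀ w → closed u w ≡ closed v w) → N[_] G u ≡ N[_] G v
  closed⇒sameN {u} {v} e = trans (sym (Vecₚ.tabulate∘lookup _)) (trans (Vecₚ.tabulate-cong λ w →
    trans (lookup-N u w) (trans (e w) (sym (lookup-N v w)))) (Vecₚ.tabulate∘lookup _))

  leaf-attached : ∀ {x} → Leaf G x → ∃ λ v → Attached pendant x v
  leaf-attached {x} leaf = let v , e = size-one (adj G x) leaf in v , edge-attached e

  attached-leaf : ∀ {x v} → Attached pendant x v → Leaf G x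
  attached-leaf {x} {v} a = one-size (adj G x) v (pendant-edge a)

  plain-connected : Connected G → IsConnected
  plain-connected (s≤s z≤n , path) = zero , λ u v → gmap id (Equivalence.to Boolₚ.T-≡) (path u v)

  connected-plain : IsConnected → Connected G
  connected-plain (v , path) = size-pos (plain G) v , λ u v → gmap id (Equivalence.from Boolₚ.T-≡) (path u v)

  plain-irreducible : NoLeaves G → NoSiblings G → Irreducible (plain G)
  plain-irreducible nl ns H m = go (Deleting.Merge.kind m) (Spot.attached (Deleting.Merge.spot m) zero)
    where
    go : ∀ k {x v} → ¬ Attached k x v
    go pendant     a       = nl _ (attached-leaf a)
    go sibling {x} {v} a = ns x v (proj₁ a , closed⇒sameN (attached-closed a))

plain-≃ : ∀ {n m} {G : Graph n} {H : Graph m} → G ≅ H → plain G ≃ plain H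
plain-≃ φ = record
  { to = π ⟨$⟩ʳ_ ; from = π ⟨$⟩ˡ_ ; to-from = λ _ → Perm.inverseʳ π ; from-to = λ _ → Perm.inverseˡ π
  ; edges = _≅_.preserves φ ; colours = λ _ → refl }
  where π = _≅_.bijection φ

≃-plain : ∀ {n m} {G : Graph n} {H : Graph m} → plain G ≃ plain H → G ≅ H
≃-plain φ = record { bijection = ≃-permutation φ ; preserves = _≃_.edges φ }

-- The common shape of removing all leaves and of contracting all siblings: every discarded vertex
-- is attached to a kept one.
record Retraction (H G : ColouredGraph ⊤) : Set where
  private
    module H = ColouredGraph H
    module G = ColouredGraph G
  field
    embed           : H.V → G.V
    embed-injective : ∀ {u v} → embed u ≡ embed v → u ≡ v
    embed-edge      : ∀ u v → G.edge (embed u) (embed v) ≡ H.edge u v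
    covered         : ∀ x → (∃ λ h → embed h ≡ x) ⊎ ∃ λ h → ∃ λ k → G.Attached k x (embed h)

-- Discarded vertices are deleted one at a time. Each remaining one is attached to a kept vertex,
-- and attachment passes to induced subgraphs, so the retraction persists.
retraction-⇒* : ∀ {H G} → Retraction H G → G ⇒* H
retraction-⇒* {H} {G} = go G (<-wellFounded _)
  where
  open ColouredGraph
  go : ∀ G → Acc _<_ (size G) → Retraction H G → G ⇒* H
  go G (acc rs) r with search G (λ x → ¬? (search H λ h → _≟_ G (Retraction.embed r h) x))
  ... | no all = Reduction.done (≃-sym record
      { to = embed ; from = λ x → proj₁ (preimage x) ; to-from = λ x → proj₂ (preimage x)
      ; from-to = λ h → embed-injective (proj₂ (preimage (embed h)))
      ; edges = embed-edge ; colours = λ _ → refl })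
    where
    open Retraction r
    preimage : ∀ x → ∃ λ h → embed h ≡ x
    preimage x = decidable-stable (search H λ h → _≟_ G (embed h) x) λ ¬p → all (x , ¬p)
  ... | yes (x , ∉) with Retraction.covered r x
  ...   | inj₁ p           = contradiction p ∉
  ...   | inj₂ (h , k , a) = Reduction.step m (go (collapse G s tt) (rs (ℕₚ.≤-reflexive (sym (merge-size m)))) record
      { embed = λ u → embed u ,, λ _ e → ∉ (u , sym e)
      ; embed-injective = embed-injective ∘ cong point
      ; embed-edge = embed-edge
      ; covered = λ y → Sum.map
          (λ (u , e) → u , Sub-≡ e)
          (λ (u , k′ , (ne , e)) → u , k′ , ne ∘ cong point , λ w w≢ →
            trans (e (point w) (λ e′ → w≢ (Sub-≡ e′))) (sym (collapse-link G s k′ _ w)))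
          (covered (point y)) })
    where
    open Retraction r
    s : Spot G k 1
    s = record { member = λ _ → x ; injective = λ { {zero} {zero} _ → refl } ; base = embed h
               ; attached = λ _ → a ; same = λ _ → refl }
    m : Deletion G (collapse G s tt)
    m = Deleting.collapse-merge s refl

module _ {n : ℕ} (G : Graph n) where
  open ColouredGraph (plain G)

  induced-retraction : ∀ {P : Fin n → Set} (P? : Decidable P) →
    (∀ x → ¬ P x → ∃ λ y → P y × ∃ λ k → Attached k x y) → Retraction (plain (induced G P?)) (plain G)
  induced-retraction {P} P? attach = record
    { embed = pick P? ; embed-injective = pick-injective P? ; embed-edge = λ _ _ → refl
    ; covered = λ x → covered x (P? x) }
    where
    covered : ∀ x → Dec (P x) → (∃ λ h → pick P? h ≡ x) ⊎ ∃ λ h → ∃ λ k → Attached k x (pick P? h)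
    covered x (yes p) = inj₁ (pick-onto P? p)
    covered x (no ¬p) = let y , p , k , a = attach x ¬p ; h , e = pick-onto P? p in
      inj₂ (h , k , subst (Attached k x) (sym e) a)

  two-vertices-K₂ : n ≡ 2 → IsConnected → G ≅ complete 2
  two-vertices-K₂ refl (_ , path) = record { bijection = Perm.id ; preserves = same }
    where
    walk : ∀ {u v : Fin 2} → Star (λ u v → adj G u v ≡ true) u v → u ≢ v → adj G zero (suc zero) ≡ true
    walk ε ne = contradiction refl ne
    walk {zero}     (_◅_ {j = suc zero} e p) ne = e
    walk {suc zero} (_◅_ {j = zero} e p)     ne = trans (adj-sym G _ _) e
    walk {zero}     (_◅_ {j = zero} e p)     ne = walk p ne
    walk {suc zero} (_◅_ {j = suc zero} e p) ne = walk p ne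
    edge-01 : adj G zero (suc zero) ≡ true
    edge-01 = walk (path zero (suc zero)) λ ()
    same : ∀ u v → adj (complete 2) u v ≡ adj G u v
    same zero       zero       = sym (adj-irrefl G zero)
    same zero       (suc zero) = sym edge-01
    same (suc zero) zero       = sym (trans (adj-sym G _ _) edge-01)
    same (suc zero) (suc zero) = sym (adj-irrefl G (suc zero))

  no-leaf-pair : IsConnected → ¬ (G ≅ complete 2) → ∀ {x y} → Attached pendant x y → ¬ Attached pendant y x
  no-leaf-pair con ¬K₂ {x} {y} a b with 3 ℕₚ.≤? n
  ... | yes 3≤ = no-K₂ (plain G) con 3≤ a b
  ... | no 3≰  = ¬K₂ (two-vertices-K₂ (ℕₚ.≤-antisym (s≤s⁻¹ (ℕₚ.≰⇒> 3≰)) (two-points (plain G) (proj₁ a))) con)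

  -- The neighbour of a leaf is itself kept: if it were a leaf, the graph would be K₂.
  deleteLeaves-⇒* : IsConnected → ¬ (G ≅ complete 2) → plain G ⇒* plain (deleteLeaves G)
  deleteLeaves-⇒* con ¬K₂ = retraction-⇒* (induced-retraction (notLeaf? G) λ x ¬¬leaf →
    let y , a = leaf-attached G (decidable-stable (Leaf? G x) ¬¬leaf) in
    y , (λ leaf → let z , b = leaf-attached G leaf in no-leaf-pair con ¬K₂ a
      (subst (Attached pendant y) (neighbour a b) b)) , pendant , a)
    where
    neighbour : ∀ {x y z} → Attached pendant x y → Attached pendant y z → z ≡ x
    neighbour {x} {y} {z} a b with z ≟ x
    ... | yes e = e
    ... | no ne = contradiction (trans (sym (attached-edge {pendant} a)) (trans (edge-sym x y)
      (trans (pendant-edge b x) (==-≢ ne)))) λ ()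

  representative : ∀ x → ∃ λ y → Representative G y × (∀ w → closed x w ≡ closed y w)
  representative x = let y , e , min = least (λ u → sameN? G u x) (x , refl) in
    y , (λ u e′ → min u (trans e′ e)) , sameN⇒closed G (sym e)

  contractSiblings-⇒* : plain G ⇒* plain (contractSiblings G)
  contractSiblings-⇒* = retraction-⇒* (induced-retraction (Representative? G) λ x ¬rep →
    let y , rep , twin = representative x in
    y , rep , sibling , closed-attached (λ e → ¬rep (subst (Representative G) (sym e) rep)) twin)

  -- Every vertex of `G` has the closed neighbourhood of some representative, so agreement on
  -- representatives extends to all of `G`. Twins after the contraction are thus twins in `G`, and
  -- both are least in their group.
  contractSiblings-noTwins : ∀ {i j} → (∀ w → ColouredGraph.closed (plain (contractSiblings G)) i w ≡
                                             ColouredGraph.closed (plain (contractSiblings G)) j w) → i ≡ j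
  contractSiblings-noTwins {i} {j} e = pick-injective rep? (Finₚ.≤-antisym
    (pick-holds rep? i _ (closed⇒sameN G (sym ∘ twin))) (pick-holds rep? j _ (closed⇒sameN G twin)))
    where
    rep? = Representative? G
    S = plain (contractSiblings G)
    pick-closed : ∀ i h → closed (pick rep? i) (pick rep? h) ≡ ColouredGraph.closed S i h
    pick-closed i h = cong (_∨ edge (pick rep? i) (pick rep? h))
      (does-⇔ (mk⇔ (pick-injective rep?) (cong (pick rep?))) (pick rep? i ≟ pick rep? h) (ColouredGraph._≟_ S i h))
    twin : ∀ w → closed (pick rep? i) w ≡ closed (pick rep? j) w
    twin w with representative w
    ... | y , rep , w~y with pick-onto rep? rep
    ...   | h , refl = trans (move i) (trans (trans (pick-closed i h) (trans (e h) (sym (pick-closed j h)))) (sym (move j)))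
      where
      move : ∀ i → closed (pick rep? i) w ≡ closed (pick rep? i) (pick rep? h)
      move i = trans (closed-sym _ w) (trans (w~y _) (closed-sym (pick rep? h) _))

  -- The vertices of K₂ are twins, and a contraction leaves none. This carries the exclusion of K₂
  -- through the whole process.
  contractSiblings-notK₂ : ¬ (contractSiblings G ≅ complete 2)
  contractSiblings-notK₂ φ = contradiction (trans (sym (Perm.inverseʳ π)) (trans (cong (π ⟨$⟩ʳ_)
    (contractSiblings-noTwins {π ⟨$⟩ˡ zero} {π ⟨$⟩ˡ suc zero} λ w → trans (full _ w) (sym (full _ w)))) (Perm.inverseʳ π))) λ ()
    where
    π = _≅_.bijection φ
    S = plain (contractSiblings G)
    full : ∀ u v → ColouredGraph.closed S u v ≡ true
    full u v with ColouredGraph._≟_ S u v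
    ... | yes refl = ColouredGraph.closed-refl S u
    ... | no u≢v   = trans (ColouredGraph.closed-≢ S u≢v) (trans (sym (_≅_.preserves φ u v))
      (cong not (dec-false (_ Finₚ.≟ _) λ e → u≢v (_≃_.to-injective (plain-≃ φ) e))))

⇒*-preserves-connected : ∀ {G H} → ColouredGraph.IsConnected G → G ⇒* H → ColouredGraph.IsConnected H
⇒*-preserves-connected con r = Reduction.▷*-closed connected-≃ con r

↠-⇒* : ∀ {n m} {G : Graph n} {H : Graph m} → ColouredGraph.IsConnected (plain G) → ¬ (G ≅ complete 2) →
       G ↠ H → plain G ⇒* plain H × Irreducible (plain H)
↠-⇒* {G = G} con ¬K₂ (stop nl ns) = Reduction.done ≃-refl , plain-irreducible G nl ns
↠-⇒* {G = G} con ¬K₂ (prune ¬nl r) =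
  let first = Reduction.▷*-trans (deleteLeaves-⇒* G con ¬K₂) (contractSiblings-⇒* (deleteLeaves G))
      rest , irr = ↠-⇒* (⇒*-preserves-connected con first) (contractSiblings-notK₂ (deleteLeaves G)) r
  in Reduction.▷*-trans first rest , irr
↠-⇒* {G = G} con ¬K₂ (merge nl ¬ns r) =
  let first = contractSiblings-⇒* G
      rest , irr = ↠-⇒* (⇒*-preserves-connected con first) (contractSiblings-notK₂ G) r
  in Reduction.▷*-trans first rest , irr

module _ {m n : ℕ} {R : Graph m} (R-con : ColouredGraph.IsConnected (plain R)) (R-irr : Irreducible (plain R))
         {G : Graph n} where

  reduction-⇒* : ConnectedWithReduction R G → plain G ⇒* plain R
  reduction-⇒* (conn con ¬K₂ (_ , H , G↠H , H≅R)) =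
    Reduction.▷*-trans (proj₁ (↠-⇒* (plain-connected G con) ¬K₂ G↠H)) (Reduction.done (plain-≃ H≅R))

  -- Single deletions also lead from K₂ to one vertex, where no reduction is defined; `n ≢ 2` rules
  -- this out. Otherwise the result of the process and `R` are irreducible graphs reached from `G`,
  -- hence isomorphic.
  ⇒*-reduction : n ≢ 2 → plain G ⇒* plain R → ConnectedWithReduction R G
  ⇒*-reduction n≢2 r = conn (connected-plain G con) ¬K₂ (k , H , G↠H ,
    ≃-plain (Reduction.normal-unique con (proj₂ G⇒*H) R-irr (proj₁ G⇒*H) r))
    where
    con = ⇒*-connected r R-con
    ¬K₂ : ¬ (G ≅ complete 2)
    ¬K₂ φ = n≢2 (↔⇒≡ (_≅_.bijection φ))
    normal = normalise G (<-wellFounded n)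
    k = proj₁ normal
    H = proj₁ (proj₂ normal)
    G↠H = proj₂ (proj₂ normal)
    G⇒*H = ↠-⇒* con ¬K₂ G↠H

reduction-≢2 : ∀ {m n} {R : Graph m} {G : Graph n} → ConnectedWithReduction R G → n ≢ 2
reduction-≢2 {G = G} (conn con ¬K₂ _) n≡2 = ¬K₂ (two-vertices-K₂ G n≡2 (plain-connected G con))

-- Sibling and tuft numbers

maximum-≤ : ∀ {n} (f : Fin n → ℕ) {b} → (∀ v → f v ≤ b) → maximum f ≤ b
maximum-≤ f f≤ = max≤v⁺ z≤n (Allₚ.tabulate⁺ f≤)

≤-maximum : ∀ {n} (f : Fin n → ℕ) v → f v ≤ maximum f
≤-maximum f v = Allₚ.tabulate⁻ (xs≤max 0 (List.tabulate f)) v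

module _ {n} {P : Fin n → Set} (P? : Decidable P) where

  injection-count : ∀ {d} (f : Fin d → Fin n) → (∀ {i j} → f i ≡ f j → i ≡ j) → (∀ i → P (f i)) → d ≤ count P?
  injection-count f f-inj pf = Finₚ.injective⇒≤ {f = λ i → proj₁ (pick-onto P? (pf i))} λ {i} {j} e →
    f-inj (trans (sym (proj₂ (pick-onto P? (pf i)))) (trans (cong (pick P?) e) (proj₂ (pick-onto P? (pf j)))))

  count-injection : ∀ {d} → d ≤ count P? →
    ∃ λ (f : Fin d → Fin n) → (∀ {i j} → f i ≡ f j → i ≡ j) × (∀ i → P (f i))
  count-injection d≤ = (λ i → pick P? (Fin.inject≤ i d≤)) , (λ e → Finₚ.inject≤-injective d≤ d≤ _ _ (pick-injective P? e))
    , λ i → pick-holds P? _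

module _ {n : ℕ} (G : Graph n) where
  open ColouredGraph (plain G)

  -- No vertex attaining the maximum is sought: if there is no such group, every count is at most
  -- `d`, and so is the maximum.
  tuft-spot : ∀ {d} → suc d ≤ tuftNumber G → ¬ ¬ Spot pendant (suc d)
  tuft-spot {d} d< ¬spot = ℕₚ.<⇒≱ d< (maximum-≤ _ λ v → ℕₚ.≮⇒≥ λ d<count →
    let f , f-inj , pf = count-injection (λ u → T? (adj G v u) ×-dec Leaf? G u) d<count in
    ¬spot record { member = f ; injective = f-inj ; base = v ; same = λ _ → refl
                 ; attached = λ i → let w , a = leaf-attached G (proj₂ (pf i)) in
                     subst (Attached pendant (f i)) (neighbour a (Equivalence.to Boolₚ.T-≡ (proj₁ (pf i)))) a })
    where
    neighbour : ∀ {x v w} → Attached pendant x w → adj G v x ≡ true → w ≡ v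
    neighbour {x} {v} {w} a e with w ≟ v
    ... | yes w≡v = w≡v
    ... | no w≢v  = contradiction (trans (sym e) (trans (adj-sym G v x) (trans (pendant-edge a v) (==-≢ w≢v)))) λ ()

  spot-tuft : ∀ {d} → Spot pendant d → d ≤ tuftNumber G
  spot-tuft s = ℕₚ.≤-trans (injection-count (λ u → T? (adj G base u) ×-dec Leaf? G u) member injective λ i →
    Equivalence.from Boolₚ.T-≡ (trans (adj-sym G _ _) (attached-edge {pendant} (attached i))) , attached-leaf G (attached i))
    (≤-maximum (λ v → count (λ u → T? (adj G v u) ×-dec Leaf? G u)) base)
    where open Spot s

  sibling-spot : ∀ {d} → suc d ≤ siblingNumber G → ¬ ¬ Spot sibling (suc d)
  sibling-spot {d} d< ¬spot = ℕₚ.<⇒≱ d< (ℕₚ.∸-monoˡ-≤ 1 (maximum-≤ _ λ v → ℕₚ.≮⇒≥ λ d<count →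
    -- The group has at least `d + 2` elements: one becomes the base and `d + 1` become members, in
    -- accordance with the subtraction of 1 in `siblingNumber`.
    let f , f-inj , pf = count-injection (λ u → sameN? G u v) d<count in
    ¬spot record { member = f ∘ suc ; injective = Finₚ.suc-injective ∘ f-inj ; base = f zero ; same = λ _ → refl
                 ; attached = λ i → closed-attached (λ e → contradiction (f-inj e) λ ())
                     (sameN⇒closed G (trans (pf (suc i)) (sym (pf zero)))) }))

  spot-sibling : ∀ {d} → Spot sibling d → d ≤ siblingNumber G
  spot-sibling {d} s = ℕₚ.∸-monoˡ-≤ 1 (ℕₚ.≤-trans
    (injection-count (λ u → sameN? G u base) class (λ {i} {j} → class-injective i j) class-same)
    (≤-maximum (λ v → count (λ u → sameN? G u v)) base))
    where
    open Spot s
    class : Fin (suc d) → Fin n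
    class zero    = base
    class (suc i) = member i
    class-injective : ∀ i j → class i ≡ class j → i ≡ j
    class-injective zero    zero    _ = refl
    class-injective zero    (suc j) e = contradiction (sym e) (≢base j)
    class-injective (suc i) zero    e = contradiction e (≢base i)
    class-injective (suc i) (suc j) e = cong suc (injective e)
    class-same : ∀ i → N[_] G (class i) ≡ N[_] G base
    class-same zero    = refl
    class-same (suc i) = closed⇒sameN G (attached-closed (attached i))

opposite : Kind → Kind
opposite sibling = pendant
opposite pendant = sibling

opposite-involutive : ∀ k → opposite (opposite k) ≡ k
opposite-involutive sibling = refl
opposite-involutive pendant = refl

deduplicate-distinct : ∀ {A : Set} {_∼_ : A → A → Set} (_∼?_ : ∀ x y → Dec (x ∼ y)) xs →
                       AllPairs (λ x y → ¬ x ∼ y) (List.deduplicate _∼?_ xs)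
deduplicate-distinct _∼?_ []       = []
deduplicate-distinct _∼?_ (x ∷ xs) = Allₚ.all-filter (λ y → ¬? (x ∼? y)) (List.deduplicate _∼?_ xs)
  ∷ AllPairsₚ.filter⁺ _ (deduplicate-distinct _∼?_ xs)

distinct-lookup : ∀ {A : Set} {_∼_ : A → A → Set} → (∀ {x y} → x ∼ y → y ∼ x) → ∀ {xs} → AllPairs (λ x y → ¬ x ∼ y) xs →
                  ∀ i j → lookup xs i ∼ lookup xs j → i ≡ j
distinct-lookup ∼-sym (_ ∷ _)  zero    zero    _ = refl
distinct-lookup ∼-sym (x∉ ∷ _) zero    (suc j) r = contradiction r (All.lookup x∉ (∈-lookup j))
distinct-lookup ∼-sym (x∉ ∷ _) (suc i) zero    r = contradiction (∼-sym r) (All.lookup x∉ (∈-lookup i))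
distinct-lookup ∼-sym (_ ∷ ps) (suc i) (suc j) r = cong suc (distinct-lookup ∼-sym ps i j r)

module _ {m : ℕ} (R : Graph m) (R-con : ColouredGraph.IsConnected (plain R)) (R-irr : Irreducible (plain R))
         (n : ℕ) (n≢2 : n ≢ 2) (d : Kind → ℕ) (τ : Kind → Kind) where
  open ColouredGraph
  open Cancellation d R-con R-irr

  Within : Graph n → Set
  Within G = siblingNumber G ≤ d (τ sibling) × tuftNumber G ≤ d (τ pendant)

  within? : Decidable Within
  within? G = siblingNumber G ℕₚ.≤? d (τ sibling) ×-dec tuftNumber G ℕₚ.≤? d (τ pendant)

  within⇒sparse : ∀ {G} → Within G → Sparse τ (plain G)
  within⇒sparse {G} (s≤ , t≤) _ sibling s = ℕₚ.<⇒≱ (spot-sibling G s) s≤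
  within⇒sparse {G} (s≤ , t≤) _ pendant s = ℕₚ.<⇒≱ (spot-tuft G s) t≤

  sparse⇒within : ∀ {G} → Sparse τ (plain G) → Within G
  sparse⇒within {G} sp =
    ℕₚ.≮⇒≥ (λ d< → sibling-spot G d< (none sibling)) , ℕₚ.≮⇒≥ (λ d< → tuft-spot G d< (none pendant))
    where
    none : ∀ k → ¬ Spot (plain G) k (suc (d (τ k)))
    -- A group provides two vertices and `n ≢ 2` a third, which is what `Sparse` asks for before it
    -- forbids anything.
    none k s = sp (ℕₚ.≤∧≢⇒< (two-points (plain G) (Spot.≢base s zero)) (n≢2 ∘ sym)) k s

  -- With one colour of weight 1 the prescribed total says that there are exactly `n` vertices, so
  -- the bound on the size adds nothing and the counted classes are those in the list.
  isoClasses-size : Size _≃_ (Bounded {⊤} {⊤} (λ _ _ → 1) (λ _ → n) τ n) (length (filter within? (isoClasses R n)))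
  isoClasses-size = record
    { rep = λ i → plain (lookup classes i)
    ; satisfies = λ i → let G∈ , w = ∈-filter⁻ within? {xs = isoClasses R n} (∈-lookup {xs = classes} i) in
        ((reduction-⇒* R-con R-irr (All.lookup reduced G∈) , λ _ → trans (sum-const n 1) (ℕₚ.*-identityʳ n))
        , within⇒sparse w) , ℕₚ.≤-refl
    ; distinct = λ e → distinct-lookup ≅-sym
        (AllPairsₚ.filter⁺ within? (deduplicate-distinct _≅?_ (filter (ConnectedWithReduction? R) (allGraphs n)))) _ _ (≃-plain e)
    ; covers = λ x p → return (cover x p) }
    where
    classes = filter within? (isoClasses R n)
    ≅-sym : ∀ {G H : Graph n} → G ≅ H → H ≅ G
    ≅-sym e = ≃-plain (≃-sym (plain-≃ e))
    reduced : All (ConnectedWithReduction R) (isoClasses R n)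
    reduced = Allₚ.deduplicate⁺ _≅?_ (Allₚ.all-filter (ConnectedWithReduction? R) (allGraphs n))
    listed : ∀ x {n} → size x ≡ n → Any (λ H → x ≃ plain H) (allGraphs n)
    listed x refl = Any.map (λ φ → ≃-fromGraph x φ λ _ → refl) (allGraphs-complete (toGraph x))
    cover : ∀ x → Bounded (λ _ _ → 1) (λ _ → n) τ n x → ∃ λ i → x ≃ plain (lookup classes i)
    cover x (((r , totals) , sp) , _) = Any.index found , lookup-index found
      where
      found : Any (λ H → x ≃ plain H) classes
      found =
        let H , H∈ , e = find (listed x (trans (sym (trans (sum-const (size x) 1) (ℕₚ.*-identityʳ _))) (totals tt)))
            reducing = ⇒*-reduction R-con R-irr n≢2 (Reduction.▷*-resp (uncolour-≃ e) r)
            H′ , H′∈ , e′ = find (Anyₚ.deduplicate⁺ _≅?_ (λ H≅ e → ≃-trans e (≃-sym (plain-≃ H≅)))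
              (lose (∈-filter⁺ (ConnectedWithReduction? R) H∈ reducing) e))
        in lose (∈-filter⁺ within? H′∈ (sparse⇒within (Sparse-≃ τ e′ sp))) e′

-- From cumulative counts to coefficients

module _ {A : Set} where

  filter-split : {P Q S : A → Set} (P? : Decidable P) (Q? : Decidable Q) (S? : Decidable S) →
    (∀ {x} → P x → Q x ⊎ S x) → (∀ {x} → Q x → P x) → (∀ {x} → S x → P x) → (∀ {x} → Q x → ¬ S x) →
    ∀ xs → length (filter P? xs) ≡ length (filter Q? xs) + length (filter S? xs)
  filter-split P? Q? S? split q⇒p s⇒p disjoint []       = refl
  filter-split P? Q? S? split q⇒p s⇒p disjoint (x ∷ xs)
    with ih ← filter-split P? Q? S? split q⇒p s⇒p disjoint xs with P? x | Q? x | S? x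
  ... | yes p | yes q | yes s = contradiction s (disjoint q)
  ... | yes p | yes q | no ¬s = cong suc ih
  ... | yes p | no ¬q | yes s = trans (cong suc ih) (sym (ℕₚ.+-suc _ _))
  ... | yes p | no ¬q | no ¬s = contradiction (split p) [ ¬q , ¬s ]
  ... | no ¬p | yes q | _     = contradiction (q⇒p q) ¬p
  ... | no ¬p | no ¬q | yes s = contradiction (s⇒p s) ¬p
  ... | no ¬p | no ¬q | no ¬s = ih

  module _ (s t : A → ℕ) (xs : List A) where

    exact : ℕ → ℕ → ℕ
    exact i j = length (filter (λ x → i ℕₚ.≟ s x ×-dec j ℕₚ.≟ t x) xs)

    below : ℕ → ℕ → ℕ
    below i j = length (filter (λ x → s x ℕₚ.≤? i ×-dec t x ℕₚ.≤? j) xs)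

    private
      row column : ℕ → ℕ → ℕ
      row    i j = length (filter (λ x → i ℕₚ.≟ s x ×-dec t x ℕₚ.≤? j) xs)
      column i j = length (filter (λ x → s x ℕₚ.≤? i ×-dec j ℕₚ.≟ t x) xs)

      ≤-zero : ∀ {a} → a ≤ 0 → 0 ≡ a
      ≤-zero z≤n = refl

      ≤-suc : ∀ {a i} → a ≤ suc i → a ≤ i ⊎ suc i ≡ a
      ≤-suc a≤ = Sum.map s≤s⁻¹ sym (ℕₚ.m≤n⇒m<n∨m≡n a≤)

      1+n≢m : ∀ {m n} → m ≤ n → suc n ≢ m
      1+n≢m m≤n refl = ℕₚ.1+n≰n m≤n

      below-row : ∀ i j → below (suc i) j ≡ below i j + row (suc i) j
      below-row i j = filter-split _ _ _
        (λ (p , q) → Sum.map (_, q) (_, q) (≤-suc p))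
        (λ (p , q) → ℕₚ.m≤n⇒m≤1+n p , q) (λ (e , q) → ℕₚ.≤-reflexive (sym e) , q)
        (λ (p , _) (e , _) → 1+n≢m p e) xs

      below-column : ∀ i j → below i (suc j) ≡ below i j + column i (suc j)
      below-column i j = filter-split _ _ _
        (λ (p , q) → Sum.map (p ,_) (p ,_) (≤-suc q))
        (λ (p , q) → p , ℕₚ.m≤n⇒m≤1+n q) (λ (p , e) → p , ℕₚ.≤-reflexive (sym e))
        (λ (_ , q) (_ , e) → 1+n≢m q e) xs

      row-exact : ∀ i j → row i (suc j) ≡ row i j + exact i (suc j)
      row-exact i j = filter-split _ _ _
        (λ (p , q) → Sum.map (p ,_) (p ,_) (≤-suc q))
        (λ (p , q) → p , ℕₚ.m≤n⇒m≤1+n q) (λ (p , e) → p , ℕₚ.≤-reflexive (sym e))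
        (λ (_ , q) (_ , e) → 1+n≢m q e) xs

      column-exact : ∀ i j → column (suc i) j ≡ column i j + exact (suc i) j
      column-exact i j = filter-split _ _ _
        (λ (p , q) → Sum.map (_, q) (_, q) (≤-suc p))
        (λ (p , q) → ℕₚ.m≤n⇒m≤1+n p , q) (λ (e , q) → ℕₚ.≤-reflexive (sym e) , q)
        (λ (p , _) (e , _) → 1+n≢m p e) xs

      same-filter : {P Q : A → Set} (P? : Decidable P) (Q? : Decidable Q) → (∀ {x} → P x → Q x) → (∀ {x} → Q x → P x) →
                    length (filter P? xs) ≡ length (filter Q? xs)
      same-filter P? Q? to from = cong length (Listₚ.filter-≐ P? Q? (to , from) xs)

      below-0-row : ∀ j → below 0 j ≡ row 0 j
      below-0-row j = same-filter _ _ (λ (p , q) → ≤-zero p , q) (λ (p , q) → ℕₚ.≤-reflexive (sym p) , q)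

      below-0-column : ∀ i → below i 0 ≡ column i 0
      below-0-column i = same-filter _ _ (λ (p , q) → p , ≤-zero q) (λ (p , q) → p , ℕₚ.≤-reflexive (sym q))

      row-0 : ∀ i → row i 0 ≡ exact i 0
      row-0 i = same-filter _ _ (λ (p , q) → p , ≤-zero q) (λ (p , q) → p , ℕₚ.≤-reflexive (sym q))

      column-0 : ∀ j → column 0 j ≡ exact 0 j
      column-0 j = same-filter _ _ (λ (p , q) → ≤-zero p , q) (λ (p , q) → ℕₚ.≤-reflexive (sym p) , q)

    -- Differencing in one variable turns `below` into `row` or `column`, and in the other into
    -- `exact`. Symmetry passes down by cancellation, with the values at 0 treated apart.
    exact-symmetric : (∀ i j → below i j ≡ below j i) → ∀ i j → exact i j ≡ exact j i
    exact-symmetric below-symmetric = exact-sym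
      where
      row-column : ∀ i j → row i j ≡ column j i
      row-column zero    j = trans (sym (below-0-row j)) (trans (below-symmetric 0 j) (below-0-column j))
      row-column (suc i) j = ℕₚ.+-cancelˡ-≡ (below i j) _ _ (trans (sym (below-row i j))
        (trans (below-symmetric (suc i) j) (trans (below-column j i) (cong (_+ column j (suc i)) (below-symmetric j i)))))
      exact-sym : ∀ i j → exact i j ≡ exact j i
      exact-sym i zero    = trans (sym (row-0 i)) (trans (row-column i 0) (column-0 i))
      exact-sym i (suc j) = ℕₚ.+-cancelˡ-≡ (row i j) _ _ (trans (sym (row-exact i j))
        (trans (row-column i (suc j)) (trans (column-exact j i) (cong (_+ exact (suc j) i) (sym (row-column i j))))))

  ∑-coefficient : ∀ (s t : A → ℕ) xs i j → (∑[ x ∈ xs ] (x^ s x y^ t x)) i j ≡ exact s t xs i j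
  ∑-coefficient s t []       i j = refl
  ∑-coefficient s t (x ∷ xs) i j with i ℕₚ.≟ s x ×-dec j ℕₚ.≟ t x
  ... | yes p = trans (cong suc (∑-coefficient s t xs i j))
                      (sym (cong length (Listₚ.filter-accept (λ x → i ℕₚ.≟ s x ×-dec j ℕₚ.≟ t x) p)))
  ... | no ¬p = trans (∑-coefficient s t xs i j)
                      (sym (cong length (Listₚ.filter-reject (λ x → i ℕₚ.≟ s x ×-dec j ℕₚ.≟ t x) ¬p)))

-- The only connected graph on two vertices is K₂, which has no reduction. This case stands alone
-- because `Sparse` does not restrict K₂.
no-K₂-class : ∀ {m} (R : Graph m) → isoClasses R 2 ≡ []
no-K₂-class {m} R = empty (Allₚ.deduplicate⁺ _≅?_ (Allₚ.all-filter (ConnectedWithReduction? R) (allGraphs 2)))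
  where
  empty : ∀ {xs} → All (ConnectedWithReduction R) xs → xs ≡ []
  empty {[]}    _        = refl
  empty {G ∷ _} reducing = contradiction refl (reduction-≢2 (All.head reducing))

theorem1p2 : ∀ {m : ℕ} (R : Graph m) →
    Connected R → NoLeaves R → NoSiblings R →
    (n : ℕ) → 1 ≤ n →
    Symmetric (∑[ G ∈ isoClasses R n ] (x^ siblingNumber G y^ tuftNumber G))
theorem1p2 R con nl ns n _ i j = trans (∑-coefficient siblingNumber tuftNumber (isoClasses R n) i j)
  (trans (exact-symmetric siblingNumber tuftNumber (isoClasses R n) (symmetric (n ℕₚ.≟ 2)) i j)
         (sym (∑-coefficient siblingNumber tuftNumber (isoClasses R n) j i)))
  where
  R-con = plain-connected R con
  R-irr = plain-irreducible R nl ns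
  symmetric : Dec (n ≡ 2) → ∀ a b → below siblingNumber tuftNumber (isoClasses R n) a b ≡
                                    below siblingNumber tuftNumber (isoClasses R n) b a
  symmetric (yes refl) a b rewrite no-K₂-class R = refl
  -- The assignment `id` bounds the sibling number by `a` and the tuft number by `b`; `opposite`
  -- exchanges the two bounds.
  symmetric (no n≢2)   a b = Cancellation.size-bounded-independent d R-con R-irr id opposite (λ _ → refl) opposite-involutive n
    (λ _ _ → 1) (λ _ → n) (tt ∷ [] , λ _ _ → here refl)
    (isoClasses-size R R-con R-irr n n≢2 d id) (isoClasses-size R R-con R-irr n n≢2 d opposite)
    where
    d : Kind → ℕ
    d sibling = a
    d pendant = b
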